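{- Let $p$ be a prime with $p \equiv 1 \pmod{3}$, and let $R = \Gamma_{\mathbb F_p}(p_1l_1,\; p_1p_2l_1(p_1+p_2+p_1p_2))$. Then $|\mathrm{Aut}(R)| = p$, and $R$ cannot be presented in the form $\Gamma_{\mathbb F_p}(p_1l_1, h(p_1,l_1))$, i.e., there is no function $h:\mathbb F_p^2\to\mathbb F_p$ such that $R$ is isomorphic to $\Gamma_{\mathbb F_p}(p_1l_1, h(p_1,l_1))$.
   Context: For a finite field $\mathbb F$ and functions $f:\mathbb F^2\to\mathbb F$, $g:\mathbb F^3\to\mathbb F$, the graph $\Gamma_{\mathbb F}(f(p_1,l_1), g(p_1,p_2,l_1))$ is the bipartite graph whose two parts are the set $P$ of points $(p_1,p_2,p_3)\in\mathbb F^3$ and the set $L$ of lines $[l_1,l_2,l_3]\in\mathbb F^3$ (two disjoint copies of $\mathbb F^3$), where a point $(p_1,p_2,p_3)$ is adjacent to a line $[l_1,l_2,l_3]$ if and only if $p_2+l_2 = f(p_1,l_1)$ and $p_3+l_3 = g(p_1,p_2,l_1)$. The graph $\Gamma_{\mathbb F}(f(p_1,l_1), h(p_1,l_1))$ is defined in the same way with $h:\mathbb F^2\to\mathbb F$ in place of $g$. $\mathrm{Aut}(\cdot)$ denotes the automorphism group of a graph. -}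

module Defs where

open import Data.Nat using (ℕ; NonZero) renaming (_+_ to _+ℕ_; _*_ to _*ℕ_)
open import Data.Nat.DivMod using (_%_; m%n<n)
open import Data.Fin using (Fin; toℕ; fromℕ<)
open import Data.Product using (_×_; _,_; Σ)
open import Data.Sum using (_⊎_; inj₁; inj₂)
open import Data.Empty using (⊥)
open import Relation.Binary.PropositionalEquality using (_≡_)

F : ℕ → Set
F p = Fin p

module _ (p : ℕ) .{{_ : NonZero p}} where
  add : F p → F p → F p
  add a b = fromℕ< (m%n<n (toℕ a +ℕ toℕ b) p)

  mul : F p → F p → F p
  mul a b = fromℕ< (m%n<n (toℕ a *ℕ toℕ b) p)

Triple : ℕ → Set
Triple p = F p × F p × F p

Vertex : ℕ → Set
Vertex p = Triple p ⊎ Triple p   -- inj₁ = point, inj₂ = line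

Incident : (p : ℕ) .{{_ : NonZero p}} →
           (F p → F p → F p) → (F p → F p → F p → F p) →
           Triple p → Triple p → Set
Incident p f g (p1 , p2 , p3) (l1 , l2 , l3) =
  (add p p2 l2 ≡ f p1 l1) × (add p p3 l3 ≡ g p1 p2 l1)

Adj : (p : ℕ) .{{_ : NonZero p}} →
      (F p → F p → F p) → (F p → F p → F p → F p) →
      Vertex p → Vertex p → Set
Adj p f g (inj₁ x) (inj₂ y) = Incident p f g x y
Adj p f g (inj₂ y) (inj₁ x) = Incident p f g x y
Adj p f g (inj₁ _) (inj₁ _) = ⊥
Adj p f g (inj₂ _) (inj₂ _) = ⊥

record Iso {V : Set} (E₁ E₂ : V → V → Set) : Set where
  field
    fwd  : V → V
    bwd  : V → V
    bwd∘fwd : ∀ v → bwd (fwd v) ≡ v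
    fwd∘bwd : ∀ v → fwd (bwd v) ≡ v
    pres : ∀ u v → E₁ u v → E₂ (fwd u) (fwd v)
    refl' : ∀ u v → E₂ (fwd u) (fwd v) → E₁ u v
open Iso public

Aut : {V : Set} → (V → V → Set) → Set
Aut E = Iso E E

-- |Aut(E)| = n : there is an enumeration Fin n → Aut(E) that hits every
-- automorphism and is injective, automorphisms being identified when
-- their underlying vertex maps agree pointwise.
AutCard : {V : Set} → (V → V → Set) → ℕ → Set
AutCard {V} E n =
  Σ (Fin n → Aut E) λ e →
    (∀ (σ : Aut E) → Σ (Fin n) λ i → ∀ v → fwd (e i) v ≡ fwd σ v)
  × (∀ i j → (∀ v → fwd (e i) v ≡ fwd (e j) v) → i ≡ j)

fR : (p : ℕ) .{{_ : NonZero p}} → F p → F p → F p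
fR p p1 l1 = mul p p1 l1

gR : (p : ℕ) .{{_ : NonZero p}} → F p → F p → F p → F p
gR p p1 p2 l1 =
  mul p (mul p (mul p p1 p2) l1) (add p (add p p1 p2) (mul p p1 p2))

R : (p : ℕ) .{{_ : NonZero p}} → Vertex p → Vertex p → Set
R p = Adj p (fR p) (gR p)

{-# OPTIONS --safe #-}
-- Put w(a, b) = ab(a + b + ab), so that the point (a, b, c) and the line [x, y, z] are adjacent iff b + y = xa
-- and c + z = xw(a, b). If a point V off a line m is collinear with points of m, then w restricted to m agrees
-- at these points with one linear function of a. On [x, y, z] the function w is a quartic with leading term
-- x²a⁴, and it is (y² - y)a² + y²a when x = 0; so five such points (a "pencil") force x = 0 and y ∈ {0, 1}.
-- The notion is self-dual, and a point forms a pencil with at most two lines whereas [0, 0, z] does so with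
-- more points; hence no automorphism exchanges points and lines. A point of [0, 0, z] is collinear with all
-- pencil points of the line only for a = -1, while on [0, 1, z] this happens for a = -1 and a = -2; hence the
-- families [0, 0, z] and [0, 1, z] are each preserved. The points (0, b, c) are those near a line of each
-- family, and the incidences b = 0, b = -1 show that the permutation of z induced on both families commutes
-- with z ↦ z + 1. So an automorphism fixes, up to a translation of the last coordinate, all these lines, all
-- points with a = 0 and all points (-1, 0, c); intersecting and joining fixed elements yields everything.
-- A graph with h(p₁, l₁) also admits translations of the second coordinate, so it has more than p automorphisms.
module Submission where

open import Defs
open import Algebra.Bundles using (CommutativeRing)
import Algebra.Properties.AbelianGroup as AbelianGroupProperties
import Algebra.Properties.Group as GroupProperties
import Algebra.Properties.Ring as RingProperties
import Algebra.Properties.Semiring.Mult.TCOptimised as Mult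
import Algebra.Solver.Ring as RingSolver
open import Algebra.Solver.Ring.AlmostCommutativeRing using (_-Raw-AlmostCommutative⟶_; fromCommutativeRing)
open import Algebra.Structures using (IsCommutativeRing)
open import Data.Empty using (⊥)
open import Data.Fin using (Fin; zero; suc; toℕ; fromℕ<; punchIn; inject≤)
open import Data.Fin.Patterns using (0F; 1F; 2F)
import Data.Fin.Properties as Finₚ
import Data.Integer as ℤ
import Data.Integer.Properties as ℤₚ
open import Data.Maybe using (Maybe; just; nothing)
open import Data.Nat as ℕ using (ℕ; zero; suc; pred; NonZero; _<_; _%_)
open import Data.Nat.Coprimality using (prime⇒coprime; coprime-Bézout)
open import Data.Nat.DivMod using (m%n<n; m<n⇒m%n≡m; [m+kn]%n≡m%n; %-distribˡ-+; %-distribˡ-*)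
open import Data.Nat.GCD using (module Bézout)
open import Data.Nat.Primality using (Prime; ¬prime[1]; composite⇒¬prime; composite[4])
import Data.Nat.Properties as ℕₚ
open import Data.Product using (Σ; ∃; _×_; _,_; proj₁; proj₂)
open import Data.Sum using (_⊎_; inj₁; inj₂)
open import Data.Sum.Properties using (inj₁-injective; inj₂-injective)
open import Data.Vec using (Vec; []; _∷_)
open import Data.Vec.Relation.Unary.All using (All; []; _∷_)
open import Function using (_∘_)
open import Level using (Level)
import Relation.Binary.Reasoning.Setoid as SetoidReasoning
open import Relation.Binary.PropositionalEquality
  using (_≡_; _≢_; refl; sym; trans; cong; cong₂; subst; subst₂; isEquivalence; module ≡-Reasoning)
open import Relation.Nullary using (¬_; Dec; yes; no; contradiction)

-- Ring identities with integer coefficients over a commutative ring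

module IntegerSolver {c ℓ : Level} (R : CommutativeRing c ℓ) where
  open ℤ using (ℤ; +_; -[1+_])
  open CommutativeRing R renaming (refl to ≈-refl; sym to ≈-sym; trans to ≈-trans)
  open Mult semiring using (1+×; ×-homo-+) renaming (_×_ to _×′_)
  open RingProperties ring using (-‿distribˡ-*; -0#≈0#)
  open AbelianGroupProperties +-abelianGroup using (⁻¹-∙-comm; ⁻¹-involutive)
  open SetoidReasoning setoid

  -- The optimised multiple `1 ×′ 1#` reduces to `1#`, so the solver's constants agree
  -- definitionally with ring terms.
  fromℤ : ℤ → Carrier
  fromℤ (+ n)    = n ×′ 1#
  fromℤ -[1+ n ] = - (suc n ×′ 1#)

  cancel-1 : ∀ x y → (1# + x) - (1# + y) ≈ x - y
  cancel-1 x y = begin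
    (1# + x) - (1# + y)       ≈⟨ +-cong (+-comm 1# x) (≈-sym (⁻¹-∙-comm 1# y)) ⟩
    (x + 1#) + (- 1# + - y)   ≈⟨ +-assoc x 1# _ ⟩
    x + (1# + (- 1# + - y))   ≈⟨ +-congˡ (≈-sym (+-assoc 1# _ _)) ⟩
    x + ((1# - 1#) + - y)     ≈⟨ +-congˡ (+-congʳ (-‿inverseʳ 1#)) ⟩
    x + (0# + - y)            ≈⟨ +-congˡ (+-identityˡ _) ⟩
    x - y                     ∎

  fromℤ-⊖ : ∀ m n → fromℤ (m ℤ.⊖ n) ≈ (m ×′ 1#) - (n ×′ 1#)
  fromℤ-⊖ m       zero    = ≈-sym (≈-trans (+-congˡ -0#≈0#) (+-identityʳ _))
  fromℤ-⊖ zero    (suc n) = ≈-sym (+-identityˡ _)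
  fromℤ-⊖ (suc m) (suc n) = begin
    fromℤ (suc m ℤ.⊖ suc n)            ≡⟨ cong fromℤ (ℤₚ.[1+m]⊖[1+n]≡m⊖n m n) ⟩
    fromℤ (m ℤ.⊖ n)                    ≈⟨ fromℤ-⊖ m n ⟩
    (m ×′ 1#) - (n ×′ 1#)                ≈⟨ cancel-1 _ _ ⟨
    (1# + m ×′ 1#) - (1# + n ×′ 1#)      ≈⟨ +-cong (1+× m 1#) (-‿cong (1+× n 1#)) ⟨
    (suc m ×′ 1#) - (suc n ×′ 1#)        ∎

  fromℤ-neg : ∀ i → fromℤ (ℤ.- i) ≈ - fromℤ i
  fromℤ-neg (+ zero)  = ≈-sym -0#≈0#
  fromℤ-neg (+ suc n) = ≈-refl
  fromℤ-neg -[1+ n ]  = ≈-sym (⁻¹-involutive _)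

  fromℤ-+ : ∀ i j → fromℤ (i ℤ.+ j) ≈ fromℤ i + fromℤ j
  fromℤ-+ (+ m)    (+ n)    = ×-homo-+ 1# m n
  fromℤ-+ (+ m)    -[1+ n ] = fromℤ-⊖ m (suc n)
  fromℤ-+ -[1+ m ] (+ n)    = ≈-trans (fromℤ-⊖ n (suc m)) (+-comm _ _)
  fromℤ-+ -[1+ m ] -[1+ n ] = begin
    - (suc (suc (m ℕ.+ n)) ×′ 1#)          ≡⟨ cong (λ k → - (suc k ×′ 1#)) (ℕₚ.+-suc m n) ⟨
    - ((suc m ℕ.+ suc n) ×′ 1#)            ≈⟨ -‿cong (×-homo-+ 1# (suc m) (suc n)) ⟩
    - (suc m ×′ 1# + suc n ×′ 1#)           ≈⟨ ⁻¹-∙-comm _ _ ⟨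
    - (suc m ×′ 1#) + - (suc n ×′ 1#)       ∎

  fromℤ-ℕ* : ∀ m j → fromℤ (+ m ℤ.* j) ≈ (m ×′ 1#) * fromℤ j
  fromℤ-ℕ* zero    j = ≈-sym (zeroˡ _)
  fromℤ-ℕ* (suc m) j = begin
    fromℤ (+ suc m ℤ.* j)                 ≡⟨ cong fromℤ (ℤₚ.suc-* (+ m) j) ⟩
    fromℤ (j ℤ.+ + m ℤ.* j)               ≈⟨ fromℤ-+ j (+ m ℤ.* j) ⟩
    fromℤ j + fromℤ (+ m ℤ.* j)           ≈⟨ +-cong (≈-sym (*-identityˡ _)) (fromℤ-ℕ* m j) ⟩
    1# * fromℤ j + (m ×′ 1#) * fromℤ j     ≈⟨ distribʳ _ _ _ ⟨
    (1# + m ×′ 1#) * fromℤ j               ≈⟨ *-congʳ (1+× m 1#) ⟨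
    (suc m ×′ 1#) * fromℤ j                ∎

  fromℤ-* : ∀ i j → fromℤ (i ℤ.* j) ≈ fromℤ i * fromℤ j
  fromℤ-* (+ m)    j = fromℤ-ℕ* m j
  fromℤ-* -[1+ m ] j = begin
    fromℤ (ℤ.- (+ suc m) ℤ.* j)           ≡⟨ cong fromℤ (ℤₚ.neg-distribˡ-* (+ suc m) j) ⟨
    fromℤ (ℤ.- (+ suc m ℤ.* j))           ≈⟨ fromℤ-neg (+ suc m ℤ.* j) ⟩
    - fromℤ (+ suc m ℤ.* j)               ≈⟨ -‿cong (fromℤ-ℕ* (suc m) j) ⟩
    - ((suc m ×′ 1#) * fromℤ j)            ≈⟨ -‿distribˡ-* _ _ ⟩
    - (suc m ×′ 1#) * fromℤ j              ∎

  morphism : CommutativeRing.rawRing ℤₚ.+-*-commutativeRing -Raw-AlmostCommutative⟶ fromCommutativeRing R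
  morphism = record
    { ⟦_⟧ = fromℤ ; +-homo = fromℤ-+ ; *-homo = fromℤ-* ; -‿homo = fromℤ-neg
    ; 0-homo = ≈-refl ; 1-homo = ≈-refl }

  fromℤ-≟ : ∀ i j → Maybe (fromℤ i ≈ fromℤ j)
  fromℤ-≟ i j with i ℤ.≟ j
  ... | yes i≡j = just (reflexive (cong fromℤ i≡j))
  ... | no  _   = nothing

  open RingSolver _ _ morphism fromℤ-≟ public

-- Residues modulo p as a commutative ring, and as a field for prime p

module Modular (p : ℕ) .{{_ : NonZero p}} where
  open ≡-Reasoning

  fromℕ : ℕ → F p
  fromℕ n = fromℕ< (m%n<n n p)

  0ₚ 1ₚ : F p
  0ₚ = fromℕ 0
  1ₚ = fromℕ 1

  -- Multiplying by the residue of `p - 1` avoids a case split at zero and lets `*-assoc` move signs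
  -- through products.
  neg : F p → F p
  neg a = mul p (fromℕ (pred p)) a

  toℕ-fromℕ : ∀ n → toℕ (fromℕ n) ≡ n % p
  toℕ-fromℕ n = Finₚ.toℕ-fromℕ< (m%n<n n p)

  fromℕ-≡ : ∀ {m n} → m % p ≡ n % p → fromℕ m ≡ fromℕ n
  fromℕ-≡ eq = Finₚ.fromℕ<-cong _ _ eq _ _

  fromℕ-toℕ : ∀ a → fromℕ (toℕ a) ≡ a
  fromℕ-toℕ a = Finₚ.toℕ-injective (trans (toℕ-fromℕ (toℕ a)) (m<n⇒m%n≡m (Finₚ.toℕ<n a)))

  fromℕ-+ : ∀ m n → add p (fromℕ m) (fromℕ n) ≡ fromℕ (m ℕ.+ n)
  fromℕ-+ m n = fromℕ-≡ (trans (cong₂ (λ s t → (s ℕ.+ t) % p) (toℕ-fromℕ m) (toℕ-fromℕ n))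
                               (sym (%-distribˡ-+ m n p)))

  fromℕ-* : ∀ m n → mul p (fromℕ m) (fromℕ n) ≡ fromℕ (m ℕ.* n)
  fromℕ-* m n = fromℕ-≡ (trans (cong₂ (λ s t → (s ℕ.* t) % p) (toℕ-fromℕ m) (toℕ-fromℕ n))
                               (sym (%-distribˡ-* m n p)))

  fromℕ-*p : ∀ k → fromℕ (k ℕ.* p) ≡ 0ₚ
  fromℕ-*p k = fromℕ-≡ ([m+kn]%n≡m%n 0 k p)

  +-comm : ∀ a b → add p a b ≡ add p b a
  +-comm a b = fromℕ-≡ (cong (_% p) (ℕₚ.+-comm (toℕ a) (toℕ b)))

  *-comm : ∀ a b → mul p a b ≡ mul p b a
  *-comm a b = fromℕ-≡ (cong (_% p) (ℕₚ.*-comm (toℕ a) (toℕ b)))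

  +-assoc : ∀ a b c → add p (add p a b) c ≡ add p a (add p b c)
  +-assoc a b c = begin
    add p (fromℕ (i ℕ.+ j)) c              ≡⟨ cong (add p (fromℕ (i ℕ.+ j))) (fromℕ-toℕ c) ⟨
    add p (fromℕ (i ℕ.+ j)) (fromℕ k)      ≡⟨ fromℕ-+ (i ℕ.+ j) k ⟩
    fromℕ (i ℕ.+ j ℕ.+ k)                  ≡⟨ cong fromℕ (ℕₚ.+-assoc i j k) ⟩
    fromℕ (i ℕ.+ (j ℕ.+ k))                ≡⟨ fromℕ-+ i (j ℕ.+ k) ⟨
    add p (fromℕ i) (fromℕ (j ℕ.+ k))      ≡⟨ cong (λ t → add p t (fromℕ (j ℕ.+ k))) (fromℕ-toℕ a) ⟩
    add p a (add p b c)                    ∎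
    where i = toℕ a ; j = toℕ b ; k = toℕ c

  *-assoc : ∀ a b c → mul p (mul p a b) c ≡ mul p a (mul p b c)
  *-assoc a b c = begin
    mul p (fromℕ (i ℕ.* j)) c              ≡⟨ cong (mul p (fromℕ (i ℕ.* j))) (fromℕ-toℕ c) ⟨
    mul p (fromℕ (i ℕ.* j)) (fromℕ k)      ≡⟨ fromℕ-* (i ℕ.* j) k ⟩
    fromℕ (i ℕ.* j ℕ.* k)                  ≡⟨ cong fromℕ (ℕₚ.*-assoc i j k) ⟩
    fromℕ (i ℕ.* (j ℕ.* k))                ≡⟨ fromℕ-* i (j ℕ.* k) ⟨
    mul p (fromℕ i) (fromℕ (j ℕ.* k))      ≡⟨ cong (λ t → mul p t (fromℕ (j ℕ.* k))) (fromℕ-toℕ a) ⟩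
    mul p a (mul p b c)                    ∎
    where i = toℕ a ; j = toℕ b ; k = toℕ c

  *-distribˡ-+ : ∀ a b c → mul p a (add p b c) ≡ add p (mul p a b) (mul p a c)
  *-distribˡ-+ a b c = begin
    mul p a (fromℕ (j ℕ.+ k))              ≡⟨ cong (λ t → mul p t (fromℕ (j ℕ.+ k))) (fromℕ-toℕ a) ⟨
    mul p (fromℕ i) (fromℕ (j ℕ.+ k))      ≡⟨ fromℕ-* i (j ℕ.+ k) ⟩
    fromℕ (i ℕ.* (j ℕ.+ k))                ≡⟨ cong fromℕ (ℕₚ.*-distribˡ-+ i j k) ⟩
    fromℕ (i ℕ.* j ℕ.+ i ℕ.* k)            ≡⟨ fromℕ-+ (i ℕ.* j) (i ℕ.* k) ⟨
    add p (mul p a b) (mul p a c)          ∎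
    where i = toℕ a ; j = toℕ b ; k = toℕ c

  *-distribʳ-+ : ∀ a b c → mul p (add p b c) a ≡ add p (mul p b a) (mul p c a)
  *-distribʳ-+ a b c = trans (*-comm _ a) (trans (*-distribˡ-+ a b c) (cong₂ (add p) (*-comm a b) (*-comm a c)))

  +-identityˡ : ∀ a → add p 0ₚ a ≡ a
  +-identityˡ a = trans (cong (add p 0ₚ) (sym (fromℕ-toℕ a))) (trans (fromℕ-+ 0 (toℕ a)) (fromℕ-toℕ a))

  *-identityˡ : ∀ a → mul p 1ₚ a ≡ a
  *-identityˡ a = trans (cong (mul p 1ₚ) (sym (fromℕ-toℕ a)))
    (trans (fromℕ-* 1 (toℕ a)) (trans (cong fromℕ (ℕₚ.*-identityˡ (toℕ a))) (fromℕ-toℕ a)))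

  neg-inverseˡ : ∀ a → add p (neg a) a ≡ 0ₚ
  neg-inverseˡ a = begin
    add p (neg a) a                                   ≡⟨ cong₂ (λ s t → add p (neg s) t) (fromℕ-toℕ a) (fromℕ-toℕ a) ⟨
    add p (mul p (fromℕ (pred p)) (fromℕ i)) (fromℕ i)  ≡⟨ cong (λ s → add p s (fromℕ i)) (fromℕ-* (pred p) i) ⟩
    add p (fromℕ (pred p ℕ.* i)) (fromℕ i)          ≡⟨ fromℕ-+ (pred p ℕ.* i) i ⟩
    fromℕ (pred p ℕ.* i ℕ.+ i)                      ≡⟨ cong fromℕ (ℕₚ.+-comm (pred p ℕ.* i) i) ⟩
    fromℕ (suc (pred p) ℕ.* i)                    ≡⟨ cong (λ q → fromℕ (q ℕ.* i)) (ℕₚ.suc-pred p) ⟩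
    fromℕ (p ℕ.* i)                                   ≡⟨ cong fromℕ (ℕₚ.*-comm p i) ⟩
    fromℕ (i ℕ.* p)                                   ≡⟨ fromℕ-*p i ⟩
    0ₚ                                                ∎
    where i = toℕ a

  isCommutativeRing : IsCommutativeRing _≡_ (add p) (mul p) neg 0ₚ 1ₚ
  isCommutativeRing = record
    { isRing = record
      { +-isAbelianGroup = record
        { isGroup = record
          { isMonoid = record
            { isSemigroup = record
              { isMagma = record { isEquivalence = isEquivalence ; ∙-cong = cong₂ (add p) }
              ; assoc = +-assoc }
            ; identity = +-identityˡ , λ a → trans (+-comm a 0ₚ) (+-identityˡ a) }
          ; inverse = neg-inverseˡ , λ a → trans (+-comm a (neg a)) (neg-inverseˡ a)
          ; ⁻¹-cong = cong neg }
        ; comm = +-comm }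
      ; *-cong = cong₂ (mul p)
      ; *-assoc = *-assoc
      ; *-identity = *-identityˡ , λ a → trans (*-comm a 1ₚ) (*-identityˡ a)
      ; distrib = *-distribˡ-+ , *-distribʳ-+ }
    ; *-comm = *-comm }

  commutativeRing : CommutativeRing _ _
  commutativeRing = record { isCommutativeRing = isCommutativeRing }

  open AbelianGroupProperties (CommutativeRing.+-abelianGroup commutativeRing) using (inverseˡ-unique)

  fromℕ-injective : ∀ {m n} → m < p → n < p → fromℕ m ≡ fromℕ n → m ≡ n
  fromℕ-injective {m} {n} m<p n<p eq = begin
    m               ≡⟨ m<n⇒m%n≡m m<p ⟨
    m % p           ≡⟨ toℕ-fromℕ m ⟨
    toℕ (fromℕ m)   ≡⟨ cong toℕ eq ⟩
    toℕ (fromℕ n)   ≡⟨ toℕ-fromℕ n ⟩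
    n % p           ≡⟨ m<n⇒m%n≡m n<p ⟩
    n               ∎

  -- The inverse is the Bézout coefficient of the representative `i`; the two constructors are its
  -- two possible signs.
  *-inverse : Prime p → ∀ a → a ≢ 0ₚ → Σ (F p) λ b → mul p b a ≡ 1ₚ
  *-inverse p-prime a a≢0 = helper (coprime-Bézout (prime⇒coprime p-prime {{ℕ.≢-nonZero i≢0}} (Finₚ.toℕ<n a)))
    where
    i = toℕ a

    i≢0 : i ≢ 0
    i≢0 eq = a≢0 (trans (sym (fromℕ-toℕ a)) (cong fromℕ eq))

    fromℕ-*a : ∀ l → mul p (fromℕ l) a ≡ fromℕ (l ℕ.* i)
    fromℕ-*a l = trans (cong (mul p (fromℕ l)) (sym (fromℕ-toℕ a))) (fromℕ-* l i)

    helper : Bézout.Identity 1 p i → Σ (F p) λ b → mul p b a ≡ 1ₚ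
    helper (Bézout.+- k l eq) = neg (fromℕ l) , (begin
      mul p (neg (fromℕ l)) a      ≡⟨ *-assoc (fromℕ (pred p)) (fromℕ l) a ⟩
      neg (mul p (fromℕ l) a)      ≡⟨ inverseˡ-unique 1ₚ _ (begin
        add p 1ₚ (mul p (fromℕ l) a)        ≡⟨ cong (add p 1ₚ) (fromℕ-*a l) ⟩
        add p 1ₚ (fromℕ (l ℕ.* i))          ≡⟨ fromℕ-+ 1 (l ℕ.* i) ⟩
        fromℕ (1 ℕ.+ l ℕ.* i)               ≡⟨ cong fromℕ eq ⟩
        fromℕ (k ℕ.* p)                     ≡⟨ fromℕ-*p k ⟩
        0ₚ                                  ∎) ⟨
      1ₚ                           ∎)
    helper (Bézout.-+ k l eq) = fromℕ l , (begin
      mul p (fromℕ l) a            ≡⟨ fromℕ-*a l ⟩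
      fromℕ (l ℕ.* i)              ≡⟨ cong fromℕ eq ⟨
      fromℕ (1 ℕ.+ k ℕ.* p)        ≡⟨ fromℕ-≡ ([m+kn]%n≡m%n 1 k p) ⟩
      1ₚ                           ∎)

  -- Repeatedly adding `1ₚ` to `0ₚ` reaches every residue, so induction on the representative
  -- applies.
  translation-unique : ∀ (f : F p → F p) → f 0ₚ ≡ 0ₚ → (∀ a → f (add p a 1ₚ) ≡ add p (f a) 1ₚ) → ∀ a → f a ≡ a
  translation-unique f f0 f+1 a = trans (cong f (sym (fromℕ-toℕ a))) (trans (go (toℕ a)) (fromℕ-toℕ a))
    where
    go : ∀ n → f (fromℕ n) ≡ fromℕ n
    go zero    = f0
    go (suc n) = begin
      f (fromℕ (suc n))      ≡⟨ cong f (succ n) ⟨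
      f (add p (fromℕ n) 1ₚ)   ≡⟨ f+1 (fromℕ n) ⟩
      add p (f (fromℕ n)) 1ₚ   ≡⟨ cong (λ s → add p s 1ₚ) (go n) ⟩
      add p (fromℕ n) 1ₚ       ≡⟨ succ n ⟩
      fromℕ (suc n)          ∎
      where
      succ : ∀ m → add p (fromℕ m) 1ₚ ≡ fromℕ (suc m)
      succ m = trans (fromℕ-+ m 1) (cong fromℕ (ℕₚ.+-comm m 1))

avoiding : ∀ {n k} → k < n → (a : Fin n) → Σ (Fin k → Fin n) λ f → (∀ {i j} → f i ≡ f j → i ≡ j) × (∀ i → f i ≢ a)
avoiding {suc n} (ℕ.s≤s k≤n) a =
  (λ i → punchIn a (inject≤ i k≤n)) ,
  (λ eq → Finₚ.inject≤-injective k≤n k≤n _ _ (Finₚ.punchIn-injective a _ _ eq)) ,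
  (λ i → Finₚ.punchInᵢ≢i a (inject≤ i k≤n))

-- The residue modulo 3 excludes 0, 2, 3 and 5, and primality excludes 1 and 4. The bound leaves
-- five abscissas besides any given one.
5<p : ∀ {p} → Prime p → p % 3 ≡ 1 → 5 < p
5<p {0} p-prime ()
5<p {1} p-prime _ = contradiction p-prime ¬prime[1]
5<p {2} _ ()
5<p {3} _ ()
5<p {4} p-prime _ = contradiction p-prime (composite⇒¬prime composite[4])
5<p {5} _ ()
5<p {suc (suc (suc (suc (suc (suc p)))))} _ _ = ℕₚ.m≤m+n 6 p

-- Adjacency notions carried along by graph isomorphisms

module _ {V : Set} where
  Joined : (V → V → Set) → V → V → Set
  Joined E u v = Σ V λ n → E n u × E n v

  -- Adjacency alone is mentioned, never points or lines, so isomorphisms carry pencils to pencils.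
  -- Five feet are one more than the degree of the quartic whose roots their abscissas will be.
  record Pencil (E : V → V → Set) (v m : V) : Set where
    field
      disjoint       : ¬ E v m
      foot           : Fin 5 → V
      foot-injective : ∀ {i j} → foot i ≡ foot j → i ≡ j
      foot-on        : ∀ i → E (foot i) m
      foot-joined    : ∀ i → Joined E (foot i) v

  Universal : (V → V → Set) → V → V → Set
  Universal E u m = E u m × (∀ v → Pencil E v m → Joined E u v)

  inverse-iso : ∀ {E E′ : V → V → Set} → Iso E E′ → Iso E′ E
  inverse-iso {E} {E′} σ = record
    { fwd = bwd σ ; bwd = fwd σ ; bwd∘fwd = fwd∘bwd σ ; fwd∘bwd = bwd∘fwd σ
    ; pres  = λ u v e → refl' σ _ _ (subst₂ E′ (sym (fwd∘bwd σ u)) (sym (fwd∘bwd σ v)) e)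
    ; refl' = λ u v e → subst₂ E′ (fwd∘bwd σ u) (fwd∘bwd σ v) (pres σ _ _ e) }

  compose-iso : ∀ {E E′ E″ : V → V → Set} → Iso E E′ → Iso E′ E″ → Iso E E″
  compose-iso σ τ = record
    { fwd = fwd τ ∘ fwd σ ; bwd = bwd σ ∘ bwd τ
    ; bwd∘fwd = λ v → trans (cong (bwd σ) (bwd∘fwd τ (fwd σ v))) (bwd∘fwd σ v)
    ; fwd∘bwd = λ v → trans (cong (fwd τ) (fwd∘bwd σ (bwd τ v))) (fwd∘bwd τ v)
    ; pres  = λ u v → pres τ _ _ ∘ pres σ u v
    ; refl' = λ u v → refl' σ u v ∘ refl' τ _ _ }

  module _ {E E′ : V → V → Set} (σ : Iso E E′) where
    fwd-injective : ∀ {u v} → fwd σ u ≡ fwd σ v → u ≡ v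
    fwd-injective eq = trans (sym (bwd∘fwd σ _)) (trans (cong (bwd σ) eq) (bwd∘fwd σ _))

    map-joined : ∀ {u v} → Joined E u v → Joined E′ (fwd σ u) (fwd σ v)
    map-joined (n , nu , nv) = fwd σ n , pres σ _ _ nu , pres σ _ _ nv

    map-pencil : ∀ {v m} → Pencil E v m → Pencil E′ (fwd σ v) (fwd σ m)
    map-pencil p = record
      { disjoint       = disjoint ∘ refl' σ _ _
      ; foot           = fwd σ ∘ foot
      ; foot-injective = foot-injective ∘ fwd-injective
      ; foot-on        = λ i → pres σ _ _ (foot-on i)
      ; foot-joined    = λ i → map-joined (foot-joined i) }
      where open Pencil p

  -- The quantifier over `v` needs the inverse: a pencil vertex of the image is pulled back, joined
  -- there, and the join is mapped forward.
  map-universal : ∀ {E E′ : V → V → Set} (σ : Iso E E′) {u m} →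
                  Universal E u m → Universal E′ (fwd σ u) (fwd σ m)
  map-universal {E} {E′} σ {u} {m} (um , univ) = pres σ _ _ um , λ v p →
    subst (Joined E′ (fwd σ u)) (fwd∘bwd σ v)
      (map-joined σ (univ (bwd σ v) (subst (Pencil E (bwd σ v)) (bwd∘fwd σ m) (map-pencil (inverse-iso σ) p))))

-- The properties of the field that the geometry uses

record PrimeField : Set₁ where
  infixl 6 _+_
  infixl 7 _*_
  infix  8 -_
  infix  4 _≟_
  field
    Carrier            : Set
    _+_ _*_            : Carrier → Carrier → Carrier
    -_                 : Carrier → Carrier
    0# 1#              : Carrier
    isCommutativeRing  : IsCommutativeRing _≡_ _+_ _*_ -_ 0# 1#
    _≟_                : (a b : Carrier) → Dec (a ≡ b)
    inverse            : ∀ a → a ≢ 0# → Σ Carrier λ b → b * a ≡ 1#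
    1+1≢0              : 1# + 1# ≢ 0#
    five-avoiding      : ∀ a → Σ (Fin 5 → Carrier) λ f → (∀ {i j} → f i ≡ f j → i ≡ j) × (∀ i → f i ≢ a)
    translation-unique : ∀ (f : Carrier → Carrier) → f 0# ≡ 0# → (∀ a → f (a + 1#) ≡ f a + 1#) → ∀ a → f a ≡ a

  commutativeRing : CommutativeRing _ _
  commutativeRing = record { isCommutativeRing = isCommutativeRing }

module Geometry (𝔽 : PrimeField) where
  open PrimeField 𝔽 renaming (Carrier to K)
  open CommutativeRing commutativeRing using (_-_; +-group; +-identityˡ; +-identityʳ; *-identityˡ; zeroˡ; zeroʳ;
    -‿inverseˡ; -‿inverseʳ)
  open GroupProperties +-group using (∙-cancelʳ)
  open IntegerSolver commutativeRing using (solve; _:+_; _:*_; :-_; _:-_; _:=_; con; Polynomial)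

  :0 :1 : ∀ {n} → Polynomial n
  :0 = con (ℤ.+ 0)
  :1 = con (ℤ.+ 1)

  infix  8 _·_
  infixl 6 _⊹_

  _·_ : ∀ k {l r} → l ≡ r → k * l ≡ k * r
  k · eq = cong (k *_) eq

  _⊹_ : ∀ {l r l′ r′} → l ≡ r → l′ ≡ r′ → l + l′ ≡ r + r′
  _⊹_ = cong₂ _+_

  -- Here l ≡ r is a linear combination of hypotheses such that u - v = l - r is a ring identity.
  abstract
    by : ∀ {u v l r} → l ≡ r → u + r ≡ v + l → u ≡ v
    by {u} {v} {l} {r} l≡r eq = ∙-cancelʳ r u v (trans eq (cong (v +_) l≡r))

  1≢0 : 1# ≢ 0#
  1≢0 1≡0 = 1+1≢0 (trans (cong₂ _+_ 1≡0 1≡0) (+-identityˡ 0#))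

  abstract
    *-cancelˡ : ∀ {k a b} → k ≢ 0# → k * a ≡ k * b → a ≡ b
    *-cancelˡ {k} {a} {b} k≢0 eq with inverse k k≢0
    ... | i , ik≡1 = by (i · eq ⊹ (b - a) · ik≡1)
      (solve 4 (λ i k a b → a :+ (i :* (k :* b) :+ (b :- a) :* :1) :=
        b :+ (i :* (k :* a) :+ (b :- a) :* (i :* k))) refl i k a b)

  *≡0 : ∀ {k a} → k ≢ 0# → k * a ≡ 0# → a ≡ 0#
  *≡0 {k} k≢0 eq = *-cancelˡ k≢0 (trans eq (sym (zeroʳ k)))

  -≡0⇒≡ : ∀ {a b} → a - b ≡ 0# → a ≡ b
  -≡0⇒≡ {a} {b} eq = by eq (solve 2 (λ a b → a :+ :0 := b :+ (a :- b)) refl a b)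

  +≡0⇒≡- : ∀ {a b} → a + b ≡ 0# → a ≡ - b
  +≡0⇒≡- {a} {b} eq = by eq (solve 2 (λ a b → a :+ :0 := :- b :+ (a :+ b)) refl a b)

  abstract
    divide : ∀ k → k ≢ 0# → ∀ a → Σ K λ q → q * k ≡ a
    divide k k≢0 a with inverse k k≢0
    ... | i , ik≡1 = a * i , by (a · ik≡1)
      (solve 3 (λ a i k → a :* i :* k :+ a :* :1 := a :+ a :* (i :* k)) refl a i k)

  -- Polynomials and their roots

  horner : ∀ {n} → Vec K n → K → K
  horner []       a = 0#
  horner (c ∷ cs) a = c + a * horner cs a

  -- Synthetic division by `a - r`, with coefficients listed from the constant term up.
  quotient : ∀ {n} → K → Vec K (suc n) → Vec K n
  quotient r (c ∷ [])         = []
  quotient r (c ∷ cs@(_ ∷ _)) = horner cs r ∷ quotient r cs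

  horner-quotient : ∀ {n} r (cs : Vec K (suc n)) a → horner cs a ≡ (a - r) * horner (quotient r cs) a + horner cs r
  horner-quotient r (c ∷ []) a = solve 3 (λ r c a → c :+ a :* :0 := (a :- r) :* :0 :+ (c :+ r :* :0)) refl r c a
  horner-quotient r (c ∷ cs@(_ ∷ _)) a = trans (cong (λ s → c + a * s) (horner-quotient r cs a))
    (solve 5 (λ r c a q s → c :+ a :* ((a :- r) :* q :+ s) := (a :- r) :* (s :+ a :* q) :+ (c :+ r :* s))
      refl r c a (horner (quotient r cs) a) (horner cs r))

  quotient-zero : ∀ {n} r (cs : Vec K (suc n)) → horner cs r ≡ 0# → All (_≡ 0#) (quotient r cs) → All (_≡ 0#) cs
  quotient-zero r (c ∷ []) eq [] = trans (solve 2 (λ c r → c := c :+ r :* :0) refl c r) eq ∷ []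
  quotient-zero r (c ∷ cs@(_ ∷ _)) eq (q ∷ qs) =
    by (eq ⊹ (- r) · q)
      (solve 3 (λ c r s → c :+ (:0 :+ (:- r) :* :0) := :0 :+ ((c :+ r :* s) :+ (:- r) :* s)) refl c r (horner cs r))
    ∷ quotient-zero r cs q qs

  -- Division by `a - r` for the first root `r` leaves a quotient that vanishes at the other roots,
  -- as they differ from `r`. There are as many roots as coefficients, one more than the degree
  -- allows.
  roots⇒zero : ∀ {n} (cs : Vec K n) (root : Fin n → K) → (∀ {i j} → root i ≡ root j → i ≡ j) →
               (∀ i → horner cs (root i) ≡ 0#) → All (_≡ 0#) cs
  roots⇒zero [] root inj eq = []
  roots⇒zero cs@(_ ∷ _) root inj eq = quotient-zero r cs (eq zero)
    (roots⇒zero (quotient r cs) (root ∘ suc) (λ e → Finₚ.suc-injective (inj e)) λ i →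
      *≡0 (λ e → Finₚ.0≢1+n (inj (sym (-≡0⇒≡ e))))
          (by (eq (suc i) ⊹ (- 1#) · eq zero ⊹ sym (horner-quotient r cs (root (suc i))))
            (solve 3 (λ q s t → q :+ (:0 :+ (:- :1) :* :0 :+ s) := :0 :+ (s :+ (:- :1) :* t :+ (q :+ t)))
              refl ((root (suc i) - r) * horner (quotient r cs) (root (suc i)))
              (horner cs (root (suc i))) (horner cs r))))
    where
    r = root zero

  -- The graph in coordinates and its translations

  W : K → K → K
  W a b = (a * b) * ((a + b) + (a * b))

  :W : ∀ {n} → Polynomial n → Polynomial n → Polynomial n
  :W a b = (a :* b) :* ((a :+ b) :+ (a :* b))

  Coords : Set
  Coords = K × K × K

  -- In the (a, b)-plane a line is the graph of `b = x * a - y`; hence the words slope for `proj₁ ℓ`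
  -- and abscissa for `proj₁ P`.
  record Inc (g : K → K → K → K) (P ℓ : Coords) : Set where
    constructor inc
    field
      eq₂ : proj₁ (proj₂ P) + proj₁ (proj₂ ℓ) ≡ proj₁ ℓ * proj₁ P
      eq₃ : proj₂ (proj₂ P) + proj₂ (proj₂ ℓ) ≡ g (proj₁ P) (proj₁ (proj₂ P)) (proj₁ ℓ)

  -- An inductive family, unlike `Adj`, so that matching on an edge reveals which end is the point.
  data Edge (g : K → K → K → K) : Coords ⊎ Coords → Coords ⊎ Coords → Set where
    point-line : ∀ {P ℓ} → Inc g P ℓ → Edge g (inj₁ P) (inj₂ ℓ)
    line-point : ∀ {P ℓ} → Inc g P ℓ → Edge g (inj₂ ℓ) (inj₁ P)

  -- Lines move oppositely to points, which preserves the sums in `Inc`. The condition on `g` covers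
  -- both graphs: it is immediate for `t = 0#`, and for every `t` if `g` ignores `b`.
  shift : ∀ g t s → (∀ a b x → g a (b + t) x ≡ g a b x) → Iso (Edge g) (Edge g)
  shift g t s g-inv = record
    { fwd = to t s ; bwd = to (- t) (- s)
    ; bwd∘fwd = to-to t s (- t) (- s) (add-neg t) (add-neg s)
    ; fwd∘bwd = to-to (- t) (- s) t s (neg-add t) (neg-add s)
    ; pres = pres-to ; refl' = refl-to }
    where
    to : K → K → Coords ⊎ Coords → Coords ⊎ Coords
    to t s (inj₁ (a , b , c)) = inj₁ (a , b + t , c + s)
    to t s (inj₂ (x , y , z)) = inj₂ (x , y + (- t) , z + (- s))

    to-to : ∀ t s t′ s′ → (∀ b → b + t + t′ ≡ b) → (∀ c → c + s + s′ ≡ c) → ∀ v → to t′ s′ (to t s v) ≡ v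
    to-to t s t′ s′ tt ss (inj₁ (a , b , c)) = cong₂ (λ b c → inj₁ (a , b , c)) (tt b) (ss c)
    to-to t s t′ s′ tt ss (inj₂ (x , y , z)) = cong₂ (λ y z → inj₂ (x , y , z)) (negated tt y) (negated ss z)
      where
      negated : ∀ {u v} → (∀ b → b + u + v ≡ b) → ∀ y → y + (- u) + (- v) ≡ y
      negated {u} {v} uv y = by (sym (uv y))
        (solve 3 (λ y u v → y :+ :- u :+ :- v :+ (y :+ u :+ v) := y :+ y) refl y u v)

    add-neg : ∀ t b → b + t + - t ≡ b
    add-neg = solve 2 (λ t b → b :+ t :+ :- t := b) refl

    neg-add : ∀ t b → b + - t + t ≡ b
    neg-add = solve 2 (λ t b → b :+ :- t :+ t := b) refl

    cancel : ∀ b y t → (b + t) + (y + (- t)) ≡ b + y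
    cancel = solve 3 (λ b y t → (b :+ t) :+ (y :+ :- t) := b :+ y) refl

    pres-inc : ∀ {a b c x y z} → Inc g (a , b , c) (x , y , z) →
               Inc g (a , b + t , c + s) (x , y + (- t) , z + (- s))
    pres-inc {a} {b} {c} {x} {y} {z} (inc e₂ e₃) =
      inc (trans (cancel b y t) e₂) (trans (cancel c z s) (trans e₃ (sym (g-inv a b x))))

    refl-inc : ∀ {a b c x y z} → Inc g (a , b + t , c + s) (x , y + (- t) , z + (- s)) →
               Inc g (a , b , c) (x , y , z)
    refl-inc {a} {b} {c} {x} {y} {z} (inc e₂ e₃) =
      inc (trans (sym (cancel b y t)) e₂) (trans (sym (cancel c z s)) (trans e₃ (g-inv a b x)))

    pres-to : ∀ u v → Edge g u v → Edge g (to t s u) (to t s v)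
    pres-to _ _ (point-line i) = point-line (pres-inc i)
    pres-to _ _ (line-point i) = line-point (pres-inc i)

    refl-to : ∀ u v → Edge g (to t s u) (to t s v) → Edge g u v
    refl-to (inj₁ _) (inj₂ _) (point-line i) = point-line (refl-inc i)
    refl-to (inj₂ _) (inj₁ _) (line-point i) = line-point (refl-inc i)

  -- Incidence: two points lie on at most one common line

  W-form : ∀ a b x → ((a * b) * x) * ((a + b) + (a * b)) ≡ x * W a b
  W-form = solve 3 (λ a b x → ((a :* b) :* x) :* ((a :+ b) :+ (a :* b)) := x :* :W a b) refl

  infix 4 _∈_
  _∈_ : Coords → Coords → Set
  _∈_ = Inc (λ a b x → x * W a b)

  E : Coords ⊎ Coords → Coords ⊎ Coords → Set
  E = Edge (λ a b x → x * W a b)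

  Collinear : Coords → Coords → Set
  Collinear P Q = ∃ λ n → P ∈ n × Q ∈ n

  equal-sums : ∀ {b b′ y k} → b + y ≡ k → b′ + y ≡ k → b ≡ b′
  equal-sums {b} {b′} {y} e e′ = ∙-cancelʳ y b b′ (trans e (sym e′))

  equal-sums′ : ∀ {b y y′ k} → b + y ≡ k → b + y′ ≡ k → y ≡ y′
  equal-sums′ {b} {y} {y′} {k} e e′ = by (e ⊹ (- 1#) · e′)
    (solve 4 (λ b y y′ k → y :+ (k :+ (:- :1) :* k) := y′ :+ ((b :+ y) :+ (:- :1) :* (b :+ y′))) refl b y y′ k)

  same-abscissa : ∀ {P Q ℓ} → P ∈ ℓ → Q ∈ ℓ → proj₁ P ≡ proj₁ Q → P ≡ Q
  same-abscissa {a , b , c} {.a , b′ , c′} {x , y , z} (inc e₂ e₃) (inc f₂ f₃) refl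
    with refl ← equal-sums e₂ f₂ with refl ← equal-sums e₃ f₃ = refl

  same-slope : ∀ {P ℓ m} → P ∈ ℓ → P ∈ m → proj₁ ℓ ≡ proj₁ m → ℓ ≡ m
  same-slope {a , b , c} {x , y , z} {.x , y′ , z′} (inc e₂ e₃) (inc f₂ f₃) refl
    with refl ← equal-sums′ e₂ f₂ with refl ← equal-sums′ e₃ f₃ = refl

  abstract
    -- The left side measures how far a point is from the line of slope `x`; `a₀` belongs to the
    -- common point of the two lines. The third coordinate obeys the same law with values of `W` in
    -- place of abscissas.
    slope-difference : ∀ {b y′ a x′ b₀ a₀ y x} → b + y′ ≡ x′ * a → b₀ + y′ ≡ x′ * a₀ → b₀ + y ≡ x * a₀ →
                       b + y - x * a ≡ (x′ - x) * (a - a₀)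
    slope-difference {b} {y′} {a} {x′} {b₀} {a₀} {y} {x} e f g = by (e ⊹ (- 1#) · f ⊹ g)
      (solve 8 (λ b y′ a x′ b₀ a₀ y x →
        b :+ y :- x :* a :+ (x′ :* a :+ (:- :1) :* (x′ :* a₀) :+ x :* a₀) :=
        (x′ :- x) :* (a :- a₀) :+ ((b :+ y′) :+ (:- :1) :* (b₀ :+ y′) :+ (b₀ :+ y))) refl b y′ a x′ b₀ a₀ y x)

  abstract
    -- With `P` on both lines the left side of `slope-difference` is zero. This excludes 4-cycles,
    -- in the two forms `line-unique` and `point-unique`.
    differences-product : ∀ {P Q ℓ m} → P ∈ ℓ → Q ∈ ℓ → P ∈ m → Q ∈ m →
                          (proj₁ P - proj₁ Q) * (proj₁ ℓ - proj₁ m) ≡ 0#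
    differences-product {a , b , c} {a′ , b′ , c′} {x , y , z} {x′ , y′ , z′} (inc e _) (inc e′ _) (inc f _) (inc f′ _) =
      by (sym (slope-difference e e′ f′) ⊹ f)
        (solve 6 (λ x x′ a a′ b y′ → (a :- a′) :* (x :- x′) :+ ((b :+ y′ :- x′ :* a) :+ x′ :* a) :=
          :0 :+ ((x :- x′) :* (a :- a′) :+ (b :+ y′)))
          refl x x′ a a′ b y′)

  line-unique : ∀ {P Q ℓ m} → P ∈ ℓ → Q ∈ ℓ → P ∈ m → Q ∈ m → P ≢ Q → ℓ ≡ m
  line-unique Pℓ Qℓ Pm Qm P≢Q = same-slope Pℓ Pm
    (-≡0⇒≡ (*≡0 (P≢Q ∘ same-abscissa Pℓ Qℓ ∘ -≡0⇒≡) (differences-product Pℓ Qℓ Pm Qm)))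

  point-unique : ∀ {P Q ℓ m} → P ∈ ℓ → P ∈ m → Q ∈ ℓ → Q ∈ m → ℓ ≢ m → P ≡ Q
  point-unique {P} {Q} {ℓ} {m} Pℓ Pm Qℓ Qm ℓ≢m = same-abscissa Pℓ Qℓ (-≡0⇒≡ (*≡0 (ℓ≢m ∘ same-slope Pℓ Pm ∘ -≡0⇒≡)
    (trans (solve 2 (λ a x → x :* a :=
      a :* x) refl (proj₁ P - proj₁ Q) (proj₁ ℓ - proj₁ m)) (differences-product Pℓ Qℓ Pm Qm))))

  -- Pencils in coordinates and their duality

  record PointPencil (V m : Coords) : Set where
    field
      disjoint       : ¬ V ∈ m
      foot           : Fin 5 → Coords
      foot-injective : ∀ {i j} → foot i ≡ foot j → i ≡ j
      foot-on        : ∀ i → foot i ∈ m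
      foot-collinear : ∀ i → Collinear (foot i) V

  line-neighbour : ∀ {u m} → E u (inj₂ m) → ∃ λ P → u ≡ inj₁ P × P ∈ m
  line-neighbour (point-line i) = _ , refl , i

  point-neighbour : ∀ {u P} → E u (inj₁ P) → ∃ λ m → u ≡ inj₂ m × P ∈ m
  point-neighbour (line-point i) = _ , refl , i

  joined⇒collinear : ∀ {P Q} → Joined E (inj₁ P) (inj₁ Q) → Collinear P Q
  joined⇒collinear (_ , line-point i , line-point j) = _ , i , j

  collinear⇒joined : ∀ {P Q} → Collinear P Q → Joined E (inj₁ P) (inj₁ Q)
  collinear⇒joined (n , i , j) = inj₂ n , line-point i , line-point j

  to-pencil : ∀ {V m} → PointPencil V m → Pencil E (inj₁ V) (inj₂ m)
  to-pencil p = record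
    { disjoint = λ { (point-line i) → disjoint i } ; foot = inj₁ ∘ foot
    ; foot-injective = foot-injective ∘ inj₁-injective
    ; foot-on = λ i → point-line (foot-on i) ; foot-joined = λ i → collinear⇒joined (foot-collinear i) }
    where
    open PointPencil p

  from-pencil : ∀ {V m} → Pencil E (inj₁ V) (inj₂ m) → PointPencil V m
  from-pencil {V} p = record
    { disjoint = disjoint ∘ point-line ; foot = λ i → proj₁ (on i)
    ; foot-injective = λ {i} {j} eq → foot-injective
      (trans (proj₁ (proj₂ (on i))) (trans (cong inj₁ eq) (sym (proj₁ (proj₂ (on j))))))
    ; foot-on = λ i → proj₂ (proj₂ (on i))
    ; foot-collinear =
      λ i → joined⇒collinear (subst (λ u → Joined E u (inj₁ V)) (proj₁ (proj₂ (on i))) (foot-joined i)) }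
    where
    open Pencil p
    on = λ i → line-neighbour (foot-on i)

  pencil-of-line : ∀ {v m} → Pencil E v (inj₂ m) → ∃ λ V → v ≡ inj₁ V
  pencil-of-line p with Pencil.foot p 0F | Pencil.foot-on p 0F | Pencil.foot-joined p 0F
  ... | _ | point-line _ | _ , line-point _ , line-point _ = _ , refl

  -- The lines joining O to the feet on m are also the feet of a pencil of m at O, so the notion is self-dual.
  dual-pencil : ∀ {v O} → Pencil E v (inj₁ O) → ∃ λ m → v ≡ inj₂ m × PointPencil O m
  dual-pencil {v} {O} p with Pencil.foot p 0F | Pencil.foot-on p 0F | Pencil.foot-joined p 0F
  ... | _ | line-point _ | _ , point-line _ , point-line {ℓ = m} _ = m , refl , record
    { disjoint = disjoint ∘ line-point
    ; foot = λ i → proj₁ (meet i)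
    ; foot-injective = λ {i} {j} eq → foot-injective (trans (proj₁ (proj₂ (on i))) (trans (cong inj₂
        (line-unique (proj₂ (proj₂ (on i))) (proj₂ (proj₂ (meet i))) (proj₂ (proj₂ (on j)))
          (subst (_∈ proj₁ (on j)) (sym eq) (proj₂ (proj₂ (meet j))))
          (λ O≡ → disjoint (line-point (subst (_∈ m) (sym O≡) (proj₁ (proj₂ (meet i))))))))
        (sym (proj₁ (proj₂ (on j))))))
    ; foot-on = λ i → proj₁ (proj₂ (meet i))
    ; foot-collinear = λ i → proj₁ (on i) , proj₂ (proj₂ (meet i)) , proj₂ (proj₂ (on i)) }
    where
    open Pencil p
    on = λ i → point-neighbour (foot-on i)

    meet : ∀ i → ∃ λ N → N ∈ m × N ∈ proj₁ (on i)
    meet i with subst (λ u → Joined E u (inj₂ m)) (proj₁ (proj₂ (on i))) (foot-joined i)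
    ... | _ , point-line j , point-line k = _ , k , j

  -- The lines that have pencils

  Bit : K → Set
  Bit y = y ≡ 0# ⊎ y ≡ 1#

  bit-idempotent : ∀ {y} → Bit y → y * y ≡ y
  bit-idempotent (inj₁ refl) = zeroˡ 0#
  bit-idempotent (inj₂ refl) = *-identityˡ 1#

  idempotent-bit : ∀ {y} → y * y - y ≡ 0# → Bit y
  idempotent-bit {y} eq with y ≟ 0#
  ... | yes y≡0 = inj₁ y≡0
  ... | no  y≢0 = inj₂ (*-cancelˡ y≢0 (by eq (solve 1 (λ y → y :* y :+ :0 := y :* :1 :+ (y :* y :- y)) refl y)))

  -- For a bit y: V lies on [0, y, z] or forms a pencil with it.
  record Near (V : Coords) (y z : K) : Set where
    constructor near
    field
      W≡ : W (proj₁ V) (proj₁ (proj₂ V)) ≡ y * proj₁ V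
      c≡ : proj₂ (proj₂ V) + z ≡ y * (proj₁ (proj₂ V) + 1#)

  abstract
    -- The abscissas of the feet are five roots of a quartic, so all coefficients vanish. Here `e`
    -- and `f` measure how far `V` is from `m`. If `e ≢ 0#`, the leading coefficient gives `x ≡ 0#`,
    -- then `c₂` makes `y` idempotent, and `c₀`, `c₁` yield `Near`.
    pencil⇒special : ∀ {V m} → PointPencil V m → ∃ λ y → ∃ λ z → m ≡ (0# , y , z) × Bit y × Near V y z
    pencil⇒special {α , β , γ} {x , y , z} p = finish (roots⇒zero coefficients abscissa abscissa-injective root)
      where
      open PointPencil p
      w e f : K
      w = W α β
      e = β + y - x * α
      f = γ + z - x * w

      -- The coefficients of e (W(a, xa - y) - w) + f (α - a) as a polynomial in a.
      coefficients : Vec K 5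
      coefficients = f * α - e * w ∷ e * (y * y) - f ∷ e * (y * y - y - (1# + 1#) * x * y)
                   ∷ e * (x + x * x - (1# + 1#) * x * y) ∷ e * (x * x) ∷ []

      abscissa : Fin 5 → K
      abscissa i = proj₁ (foot i)

      abscissa-injective : ∀ {i j} → abscissa i ≡ abscissa j → i ≡ j
      abscissa-injective {i} {j} eq = foot-injective (same-abscissa (foot-on i) (foot-on j) eq)

      -- For the joining line of slope `x′`, `e` and `f` are `x′ - x` times the differences of
      -- abscissas and of `W`; cross-multiplying eliminates `x′`.
      foot-equation : ∀ {N} → N ∈ (x , y , z) → Collinear N (α , β , γ) →
                      e * (w - W (proj₁ N) (x * proj₁ N - y)) ≡ f * (α - proj₁ N)
      foot-equation {a , b , c} (inc g₂ g₃) ((x′ , y′ , z′) , inc h₂ h₃ , inc k₂ k₃) =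
        subst (λ b → e * (w - W a b) ≡ f * (α - a)) b≡
          (by ((w - W a b) · slope-difference k₂ h₂ g₂ ⊹ (- (α - a)) · slope-difference k₃ h₃ g₃)
            (solve 8 (λ e f w v α a x x′ →
              e :* (w :- v) :+ ((w :- v) :* ((x′ :- x) :* (α :- a)) :+ (:- (α :- a)) :* ((x′ :- x) :* (w :- v))) :=
              f :* (α :- a) :+ ((w :- v) :* e :+ (:- (α :- a)) :* f))
              refl e f w (W a b) α a x x′))
        where
        b≡ : b ≡ x * a - y
        b≡ = by g₂ (solve 4 (λ b x a y → b :+ x :* a := x :* a :- y :+ (b :+ y)) refl b x a y)

      root : ∀ i → horner coefficients (abscissa i) ≡ 0#
      root i = by (sym (foot-equation (foot-on i) (foot-collinear i)))
        (solve 7 (λ e f w α a x y →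
          ((f :* α :- e :* w) :+ a :* ((e :* (y :* y) :- f) :+ a :* (e :* (y :* y :- y :- (:1 :+ :1) :* x :* y) :+
            a :* (e :* (x :+ x :* x :- (:1 :+ :1) :* x :* y) :+ a :* (e :* (x :* x) :+ a :* :0)))))
            :+ e :* (w :- :W a (x :* a :- y)) := :0 :+ f :* (α :- a)) refl e f w α (abscissa i) x y)

      finish : All (_≡ 0#) coefficients → ∃ λ y₁ → ∃ λ z₁ →
               (x , y , z) ≡ (0# , y₁ , z₁) × Bit y₁ × Near (α , β , γ) y₁ z₁
      finish (c₀ ∷ c₁ ∷ c₂ ∷ c₃ ∷ c₄ ∷ []) with e ≟ 0#
      -- With `e` zero, `c₁` forces `f` to be zero, which puts `V` on `m`.
      ... | yes e≡0 = contradiction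
        (inc (by e≡0 (solve 4 (λ β y x α → β :+ y :+ :0 := x :* α :+ (β :+ y :- x :* α)) refl β y x α))
             (by ((y * y) · e≡0 ⊹ (- 1#) · c₁)
               (solve 6 (λ γ z x w e y → γ :+ z :+ (y :* y :* :0 :+ (:- :1) :* :0) :=
                 x :* w :+ (y :* y :* e :+ (:- :1) :* (e :* (y :* y) :- (γ :+ z :- x :* w)))) refl γ z x w e y)))
        disjoint
      ... | no e≢0 = y , z , cong (_, y , z) x≡0 , bit , near w≡ γ≡
        where
        x≡0 : x ≡ 0#
        x≡0 with x ≟ 0#
        ... | yes x≡0 = x≡0
        ... | no  x≢0 = *≡0 x≢0 (*≡0 e≢0 c₄)

        bit : Bit y
        bit = idempotent-bit (by (*≡0 e≢0 c₂ ⊹ ((1# + 1#) * y) · x≡0)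
          (solve 2 (λ x y → y :* y :- y :+ (:0 :+ (:1 :+ :1) :* y :* :0) :=
            :0 :+ ((y :* y :- y :- (:1 :+ :1) :* x :* y) :+ (:1 :+ :1) :* y :* x)) refl x y))

        -- The combination `c₀ + α * c₁` eliminates `f`.
        w≡ : w ≡ y * α
        w≡ = *-cancelˡ e≢0 (by ((- 1#) · c₀ ⊹ (- α) · c₁ ⊹ (e * α) · bit-idempotent bit)
          (solve 5 (λ e f w α y → e :* w :+ ((:- :1) :* :0 :+ (:- α) :* :0 :+ e :* α :* y) :=
             e :* (y :* α) :+ ((:- :1) :* (f :* α :- e :* w) :+ (:- α) :* (e :* (y :* y) :- f) :+ e :* α :* (y :* y))) refl e f w α y))

        γ≡ : γ + z ≡ y * (β + 1#)
        γ≡ = by ((- 1#) · c₁ ⊹ (β + y - x * α + 1#) · bit-idempotent bit ⊹ (w - y * α) · x≡0)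
          (solve 7 (λ γ z y β x w α → γ :+ z :+ ((:- :1) :* :0 :+ (β :+ y :- x :* α :+ :1) :* y :+ (w :- y :* α) :* :0) :=
             y :* (β :+ :1) :+ ((:- :1) :* ((β :+ y :- x :* α) :* (y :* y) :- (γ :+ z :- x :* w)) :+
               (β :+ y :- x :* α :+ :1) :* (y :* y) :+ (w :- y :* α) :* x))
           refl γ z y β x w α)

  W-0ˡ : ∀ b → W 0# b ≡ 0#
  W-0ˡ = solve 1 (λ b → :W :0 b := :0) refl

  W-0ʳ : ∀ a → W a 0# ≡ 0#
  W-0ʳ = solve 1 (λ a → :W a :0 := :0) refl

  abstract
    -- At `b = - y` the value of `W` is `(y * y - y) * (a * a) + y * y * a`, whose quadratic term
    -- vanishes for a bit.
    W-bit : ∀ {y} → Bit y → ∀ {a b} → b + y ≡ 0# → W a b ≡ y * a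
    W-bit {y} bit {a} {b} b+y≡0 = subst (λ b → W a b ≡ y * a) (sym (+≡0⇒≡- b+y≡0))
      (by ((a + a * a) · bit-idempotent bit)
        (solve 2 (λ a y → :W a (:- y) :+ (a :+ a :* a) :* y := y :* a :+ (a :+ a :* a) :* (y :* y)) refl a y))

  ∈-horizontal : ∀ {a b c y z} → b + y ≡ 0# → c + z ≡ 0# → (a , b , c) ∈ (0# , y , z)
  ∈-horizontal {a} {b} e f = inc (trans e (sym (zeroˡ a))) (trans f (sym (zeroˡ (W a b))))

  abstract
    horizontal⇒ : ∀ {a b c y z} → (a , b , c) ∈ (0# , y , z) → b + y ≡ 0# × c + z ≡ 0#
    horizontal⇒ {a} {b} (inc e f) = trans e (zeroˡ a) , trans f (zeroˡ (W a b))

  near⇒on : ∀ {a b c y z} → Bit y → Near (a , b , c) y z → b + y ≡ 0# → (a , b , c) ∈ (0# , y , z)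
  near⇒on {a} {b} {c} {y} {z} bit (near _ c≡) b+y≡0 = ∈-horizontal b+y≡0
    (by (c≡ ⊹ y · b+y≡0 ⊹ (- 1#) · bit-idempotent bit)
      (solve 4 (λ b c y z → c :+ z :+ (y :* (b :+ :1) :+ y :* :0 :+ (:- :1) :* y) :=
        :0 :+ (c :+ z :+ y :* (b :+ y) :+ (:- :1) :* (y :* y))) refl b c y z))

  on⇒near : ∀ {a b c y z} → Bit y → (a , b , c) ∈ (0# , y , z) → Near (a , b , c) y z
  on⇒near {a} {b} {c} {y} {z} bit i with horizontal⇒ i
  ... | b+y≡0 , c+z≡0 = near (W-bit bit b+y≡0)
    (by (c+z≡0 ⊹ (- y) · b+y≡0 ⊹ bit-idempotent bit)
      (solve 4 (λ b c y z → c :+ z :+ (:0 :+ (:- y) :* :0 :+ y) :=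
        y :* (b :+ :1) :+ (c :+ z :+ (:- y) :* (b :+ y) :+ y :* y)) refl b c y z))

  abstract
    -- The second coordinates determine the slope. The third then agree because `W` is `y` times the
    -- abscissa at both points and `y * (β + y) = y * (β + 1#)` for a bit.
    near⇒collinear : ∀ {a b c α β γ y z} → Bit y → (a , b , c) ∈ (0# , y , z) → Near (α , β , γ) y z → a ≢ α →
                     Collinear (a , b , c) (α , β , γ)
    near⇒collinear {a} {b} {c} {α} {β} {γ} {y} {z} bit i (near w≡ c≡) a≢α = (x , x * α - β , x * W α β - γ) ,
      inc (by (b+y≡0 ⊹ x≡)
            (solve 6 (λ a b x α β y → b :+ (x :* α :- β) :+ (:0 :+ (β :+ y)) :=
              x :* a :+ (b :+ y :+ x :* (α :- a))) refl a b x α β y))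
          (subst₂ (λ w v → c + (x * w - γ) ≡ x * v) (sym w≡) (sym (W-bit bit b+y≡0))
            (by (c+z≡0 ⊹ rise)
              (solve 6 (λ c x s t γ z → c :+ (x :* s :- γ) :+ (:0 :+ (γ :+ z)) :=
                x :* t :+ (c :+ z :+ (x :* s :- x :* t))) refl c x (y * α) (y * a) γ z))) ,
      inc (solve 3 (λ β x α → β :+ (x :* α :- β) := x :* α) refl β x α)
          (solve 3 (λ γ x w → γ :+ (x :* w :- γ) := x :* w) refl γ x (W α β))
      where
      b+y≡0 : b + y ≡ 0#
      b+y≡0 = proj₁ (horizontal⇒ i)

      c+z≡0 : c + z ≡ 0#
      c+z≡0 = proj₂ (horizontal⇒ i)

      slope : Σ K λ q → q * (α - a) ≡ β + y
      slope = divide (α - a) (λ eq → a≢α (sym (-≡0⇒≡ eq))) (β + y)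

      x : K
      x = proj₁ slope

      x≡ : x * (α - a) ≡ β + y
      x≡ = proj₂ slope

      rise : x * (y * α) - x * (y * a) ≡ γ + z
      rise = by (y · x≡ ⊹ bit-idempotent bit ⊹ (- 1#) · c≡)
        (solve 7 (λ x y α a β γ z →
          x :* (y :* α) :- x :* (y :* a) :+ (y :* (β :+ y) :+ y :+ (:- :1) :* (y :* (β :+ :1))) :=
           γ :+ z :+ (y :* (x :* (α :- a)) :+ y :* y :+ (:- :1) :* (γ :+ z))) refl x y α a β γ z)

  abstract
    -- By `near⇒collinear` every point of the line with abscissa other than `α` can serve as a foot.
    near⇒pencil : ∀ {α β γ y z} → Bit y → Near (α , β , γ) y z → β + y ≢ 0# → PointPencil (α , β , γ) (0# , y , z)
    near⇒pencil {α} {β} {γ} {y} {z} bit n β+y≢0 with five-avoiding α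
    ... | a , a-injective , a≢α = record
      { disjoint = β+y≢0 ∘ proj₁ ∘ horizontal⇒
      ; foot = λ i → a i , - y , - z
      ; foot-injective = a-injective ∘ cong proj₁
      ; foot-on = on
      ; foot-collinear = λ i → near⇒collinear bit (on i) n (a≢α i) }
      where
      on : ∀ i → (a i , - y , - z) ∈ (0# , y , z)
      on i = ∈-horizontal (-‿inverseˡ y) (-‿inverseˡ z)

  near-axis : ∀ {b c y z} → c + z ≡ y * (b + 1#) → Near (0# , b , c) y z
  near-axis {b} {y = y} eq = near (trans (W-0ˡ b) (sym (zeroʳ y))) eq

  axis-pencil : ∀ {b z} → b ≢ 0# → PointPencil (0# , b , - z) (0# , 0# , z)
  axis-pencil {b} {z} b≢0 = near⇒pencil (inj₁ refl)
    (near-axis (trans (-‿inverseˡ z) (sym (zeroˡ (b + 1#))))) (b≢0 ∘ trans (sym (+-identityʳ b)))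

  -- Once the bit is chosen, the third-coordinate condition of `Near` determines `z`.
  pencil-candidates : ∀ {a b c m} → PointPencil (a , b , c) m → m ≡ (0# , 0# , - c) ⊎ m ≡ (0# , 1# , b + 1# - c)
  pencil-candidates {a} {b} {c} p with pencil⇒special p
  ... | _ , z , refl , inj₁ refl , near _ c≡ = inj₁ (cong (λ z → 0# , 0# , z)
    (by c≡ (solve 3 (λ z b c → z :+ :0 :* (b :+ :1) := :- c :+ (c :+ z)) refl z b c)))
  ... | _ , z , refl , inj₂ refl , near _ c≡ = inj₂ (cong (λ z → 0# , 1# , z)
    (by c≡ (solve 3 (λ z b c → z :+ :1 :* (b :+ :1) := b :+ :1 :- c :+ (c :+ z)) refl z b c)))

  three-pencils : ∀ {O m₀ m₁ m₂} → PointPencil O m₀ → PointPencil O m₁ → PointPencil O m₂ →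
                  m₀ ≡ m₁ ⊎ m₀ ≡ m₂ ⊎ m₁ ≡ m₂
  three-pencils p₀ p₁ p₂ with pencil-candidates p₀ | pencil-candidates p₁ | pencil-candidates p₂
  ... | inj₁ e | inj₁ f | _      = inj₁ (trans e (sym f))
  ... | inj₂ e | inj₂ f | _      = inj₁ (trans e (sym f))
  ... | inj₁ e | inj₂ _ | inj₁ g = inj₂ (inj₁ (trans e (sym g)))
  ... | inj₂ e | inj₁ _ | inj₂ g = inj₂ (inj₁ (trans e (sym g)))
  ... | inj₁ _ | inj₂ f | inj₂ g = inj₂ (inj₂ (trans f (sym g)))
  ... | inj₂ _ | inj₁ f | inj₁ g = inj₂ (inj₂ (trans f (sym g)))

  -- Automorphisms preserve the two sides

  IsPoint IsLine : Coords ⊎ Coords → Set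
  IsPoint v = ∃ λ P → v ≡ inj₁ P
  IsLine  v = ∃ λ ℓ → v ≡ inj₂ ℓ

  line-if-not-point : ∀ v → (∀ P → v ≢ inj₁ P) → IsLine v
  line-if-not-point (inj₁ P) ≢P = contradiction refl (≢P P)
  line-if-not-point (inj₂ ℓ) _  = ℓ , refl

  neighbour-of-line : ∀ {u v} → E u v → IsLine u → IsPoint v
  neighbour-of-line (line-point _) (_ , refl) = _ , refl

  neighbour-of-point : ∀ {u v} → E u v → IsPoint u → IsLine v
  neighbour-of-point (point-line _) (_ , refl) = _ , refl

  -- A point has at most two pencil lines, but (0, b, -z) is a pencil point of [0, 0, z] for every b ≠ 0.
  abstract
    special-line-to-line : ∀ (σ : Iso E E) z → IsLine (fwd σ (inj₂ (0# , 0# , z)))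
    special-line-to-line σ z = line-if-not-point _ impossible
      where
      b : Fin 5 → K
      b = proj₁ (five-avoiding 0#)

      b-injective : ∀ {i j} → b i ≡ b j → i ≡ j
      b-injective = proj₁ (proj₂ (five-avoiding 0#))

      impossible : ∀ O → fwd σ (inj₂ (0# , 0# , z)) ≢ inj₁ O
      impossible O eq =
        clash (three-pencils (proj₂ (proj₂ (image 0F))) (proj₂ (proj₂ (image 1F))) (proj₂ (proj₂ (image 2F))))
        where
        image : ∀ i → ∃ λ m → fwd σ (inj₁ (0# , b i , - z)) ≡ inj₂ m × PointPencil O m
        image i = dual-pencil (subst (Pencil E _) eq (map-pencil σ (to-pencil (axis-pencil (proj₂ (proj₂ (five-avoiding 0#)) i)))))

        same-image : ∀ i j → proj₁ (image i) ≡ proj₁ (image j) → i ≡ j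
        same-image i j mᵢ≡mⱼ = b-injective (cong (proj₁ ∘ proj₂) (inj₁-injective (fwd-injective σ
          (trans (proj₁ (proj₂ (image i))) (trans (cong inj₂ mᵢ≡mⱼ) (sym (proj₁ (proj₂ (image j)))))))))

        clash : proj₁ (image 0F) ≡ proj₁ (image 1F) ⊎ proj₁ (image 0F) ≡ proj₁ (image 2F) ⊎
                proj₁ (image 1F) ≡ proj₁ (image 2F) → ⊥
        clash (inj₁ e)        = contradiction (same-image 0F 1F e) λ ()
        clash (inj₂ (inj₁ e)) = contradiction (same-image 0F 2F e) λ ()
        clash (inj₂ (inj₂ e)) = contradiction (same-image 1F 2F e) λ ()

  ∈-axis : ∀ x y z → (0# , - y , - z) ∈ (x , y , z)
  ∈-axis x y z = inc (trans (-‿inverseˡ y) (sym (zeroʳ x)))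
    (trans (-‿inverseˡ z) (sym (trans (cong (x *_) (W-0ˡ (- y))) (zeroʳ x))))

  ∈-zero-ordinate : ∀ {a x y z} → y ≡ x * a → (a , 0# , - z) ∈ (x , y , z)
  ∈-zero-ordinate {a} {x} {y} {z} y≡ = inc (trans (+-identityˡ y) y≡)
    (trans (-‿inverseˡ z) (sym (trans (cong (x *_) (W-0ʳ a)) (zeroʳ x))))

  -- [x, y, z] is reached from [0, 0, z] through (1, 0, -z), [y, y, z] and (0, -y, -z).
  abstract
    line-to-line : ∀ (σ : Iso E E) ℓ → IsLine (fwd σ (inj₂ ℓ))
    line-to-line σ (x , y , z) =
      neighbour-of-point (pres σ _ _ (point-line (∈-axis x y z)))
        (neighbour-of-line (pres σ _ _ (line-point (∈-axis y y z)))
          (neighbour-of-point (pres σ _ _ (point-line (∈-zero-ordinate {1#} (solve 1 (λ y → y := y :* :1) refl y))))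
            (neighbour-of-line (pres σ _ _ (line-point (∈-zero-ordinate {1#} {0#} (sym (zeroˡ 1#)))))
              (special-line-to-line σ z))))

  horizontal-through : ∀ a b c → (a , b , c) ∈ (0# , - b , - c)
  horizontal-through a b c = ∈-horizontal (-‿inverseʳ b) (-‿inverseʳ c)

  abstract
    point-to-point : ∀ (σ : Iso E E) P → IsPoint (fwd σ (inj₁ P))
    point-to-point σ (a , b , c) =
      neighbour-of-line (pres σ _ _ (line-point (horizontal-through a b c))) (line-to-line σ _)

  -- Universal points of the special lines

  PointUniversal : Coords → Coords → Set
  PointUniversal P m = P ∈ m × (∀ V → PointPencil V m → Collinear P V)

  to-universal : ∀ {P m} → PointUniversal P m → Universal E (inj₁ P) (inj₂ m)
  to-universal {P} {m} (i , univ) = point-line i , joined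
    where
    joined : ∀ v → Pencil E v (inj₂ m) → Joined E (inj₁ P) v
    joined (inj₁ V) p = collinear⇒joined (univ V (from-pencil p))
    joined (inj₂ n) p with () ← proj₂ (pencil-of-line p)

  from-universal : ∀ {P m} → Universal E (inj₁ P) (inj₂ m) → PointUniversal P m
  from-universal (point-line i , univ) = i , λ V p → joined⇒collinear (univ (inj₁ V) (to-pencil p))

  -- The criterion says that no pencil point of the line has abscissa a.
  universal-if : ∀ {a b c y z} → Bit y → (a , b , c) ∈ (0# , y , z) → (∀ β → W a β ≡ y * a → β + y ≡ 0#) →
                 PointUniversal (a , b , c) (0# , y , z)
  universal-if {a} {b} {c} {y} {z} bit i W⇒ = i , collinear
    where
    collinear : ∀ V → PointPencil V (0# , y , z) → Collinear (a , b , c) V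
    collinear (α , β , γ) p with pencil⇒special p
    ... | _ , _ , refl , _ , n = near⇒collinear bit i n λ { refl →
      PointPencil.disjoint p (near⇒on bit n (W⇒ β (Near.W≡ n))) }

  -- Collinear points with equal abscissas coincide, whereas the universal point has second
  -- coordinate zero.
  universal⇒no-pencil-above : ∀ {a b c β z} → PointUniversal (a , b , c) (0# , 0# , z) → β ≢ 0# →
                              ¬ PointPencil (a , β , - z) (0# , 0# , z)
  universal⇒no-pencil-above {b = b} (i , univ) β≢0 p with univ _ p
  ... | _ , j , k = β≢0 (trans (sym (cong (proj₁ ∘ proj₂) (same-abscissa j k refl)))
    (trans (sym (+-identityʳ b)) (proj₁ (horizontal⇒ i))))

  -- For any other `a` there is a pencil point with the same abscissa: on the axis if `a` is zero,
  -- otherwise over a nonzero root `β` of `W a`.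
  universal-zero : ∀ {a b c z} → PointUniversal (a , b , c) (0# , 0# , z) → a ≡ - 1#
  universal-zero {a} {b} {c} {z} u with a ≟ 0# | a ≟ - 1#
  ... | _        | yes a≡-1 = a≡-1
  ... | yes refl | no _     = contradiction (axis-pencil 1≢0) (universal⇒no-pencil-above u 1≢0)
  ... | no a≢0   | no a≢-1  = contradiction pencil (universal⇒no-pencil-above u β≢0)
    where
    -- The nonzero root solves `a + β + a * β = 0`.
    quot : Σ K λ q → q * (a + 1#) ≡ - a
    quot = divide (a + 1#) (λ eq → a≢-1 (+≡0⇒≡- eq)) (- a)

    β : K
    β = proj₁ quot

    β≢0 : β ≢ 0#
    β≢0 β≡0 = a≢0 (by ((- (a + 1#)) · β≡0 ⊹ proj₂ quot)
      (solve 2 (λ a β → a :+ ((:- (a :+ :1)) :* :0 :+ :- a) :=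
        :0 :+ ((:- (a :+ :1)) :* β :+ β :* (a :+ :1))) refl a β))

    pencil : PointPencil (a , β , - z) (0# , 0# , z)
    pencil = near⇒pencil (inj₁ refl)
      (near (by ((a * β) · proj₂ quot)
        (solve 2 (λ a β → :W a β :+ a :* β :* (:- a) := :0 :* a :+ a :* β :* (β :* (a :+ :1))) refl a β))
            (trans (-‿inverseˡ z) (sym (zeroˡ _))))
      (β≢0 ∘ trans (sym (+-identityʳ β)))

  -- `W (- 1#) β` is just `β`, so the criterion is a linear equation with a single root, here and
  -- for the bit 1.
  minus-one-universal-zero : ∀ {b c z} → (- 1# , b , c) ∈ (0# , 0# , z) →
                             PointUniversal (- 1# , b , c) (0# , 0# , z)
  minus-one-universal-zero i = universal-if (inj₁ refl) i λ β eq →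
    by eq (solve 1 (λ β → β :+ :0 :+ :0 :* (:- :1) := :0 :+ :W (:- :1) β) refl β)

  minus-one-universal-one : ∀ {b c z} → (- 1# , b , c) ∈ (0# , 1# , z) → PointUniversal (- 1# , b , c) (0# , 1# , z)
  minus-one-universal-one i = universal-if (inj₂ refl) i λ β eq →
    by eq (solve 1 (λ β → β :+ :1 :+ :1 :* (:- :1) := :0 :+ :W (:- :1) β) refl β)

  -- At abscissa -2 the condition becomes `2 (β + 1)² = 0`, whose double root lies on the line
  -- itself.
  minus-two-universal-one : ∀ {b c z} → (- (1# + 1#) , b , c) ∈ (0# , 1# , z) →
                            PointUniversal (- (1# + 1#) , b , c) (0# , 1# , z)
  minus-two-universal-one i = universal-if (inj₂ refl) i λ β eq → square-zero (*≡0 1+1≢0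
    (by eq (solve 1 (λ β → (:1 :+ :1) :* ((β :+ :1) :* (β :+ :1)) :+ :1 :* (:- (:1 :+ :1)) :=
      :0 :+ :W (:- (:1 :+ :1)) β) refl β)))
    where
    square-zero : ∀ {a} → a * a ≡ 0# → a ≡ 0#
    square-zero {a} eq with a ≟ 0#
    ... | yes a≡0 = a≡0
    ... | no  a≢0 = *≡0 a≢0 eq

  -- The action of an automorphism on the special lines

  module Automorphism (σ : Iso E E) where
    φ ψ : Coords → Coords
    φ P = proj₁ (point-to-point σ P)
    ψ ℓ = proj₁ (line-to-line σ ℓ)

    φ≡ : ∀ P → fwd σ (inj₁ P) ≡ inj₁ (φ P)
    φ≡ P = proj₂ (point-to-point σ P)

    ψ≡ : ∀ ℓ → fwd σ (inj₂ ℓ) ≡ inj₂ (ψ ℓ)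
    ψ≡ ℓ = proj₂ (line-to-line σ ℓ)

    φ-injective : ∀ {P Q} → φ P ≡ φ Q → P ≡ Q
    φ-injective {P} {Q} eq = inj₁-injective (fwd-injective σ (trans (φ≡ P) (trans (cong inj₁ eq) (sym (φ≡ Q)))))

    ψ-injective : ∀ {ℓ m} → ψ ℓ ≡ ψ m → ℓ ≡ m
    ψ-injective {ℓ} {m} eq = inj₂-injective (fwd-injective σ (trans (ψ≡ ℓ) (trans (cong inj₂ eq) (sym (ψ≡ m)))))

    map-∈ : ∀ {P ℓ} → P ∈ ℓ → φ P ∈ ψ ℓ
    map-∈ {P} {ℓ} i = unwrap (subst₂ E (φ≡ P) (ψ≡ ℓ) (pres σ _ _ (point-line i)))
      where
      unwrap : ∀ {Q m} → E (inj₁ Q) (inj₂ m) → Q ∈ m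
      unwrap (point-line j) = j

    map-∈-to : ∀ {P ℓ m} → ψ ℓ ≡ m → P ∈ ℓ → φ P ∈ m
    map-∈-to {P} eq i = subst (φ P ∈_) eq (map-∈ i)

    map-point-pencil : ∀ {V m} → PointPencil V m → PointPencil (φ V) (ψ m)
    map-point-pencil {V} {m} p = from-pencil (subst₂ (Pencil E) (φ≡ V) (ψ≡ m) (map-pencil σ (to-pencil p)))

    map-point-universal : ∀ {P m} → PointUniversal P m → PointUniversal (φ P) (ψ m)
    map-point-universal {P} {m} u =
      from-universal (subst₂ (Universal E) (φ≡ P) (ψ≡ m) (map-universal σ (to-universal u)))

    map-special : ∀ {y} → Bit y → ∀ z → ∃ λ y′ → ∃ λ z′ → ψ (0# , y , z) ≡ (0# , y′ , z′) × Bit y′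
    -- One pencil point suffices; the axis point with `b = 1` is off the line for either bit, as 1
    -- and 2 are nonzero.
    map-special {y} bit z = unwrap (pencil⇒special (map-point-pencil (near⇒pencil {0#} {1#} {y * (1# + 1#) - z} bit
        (near-axis (solve 2 (λ y z → y :* (:1 :+ :1) :- z :+ z := y :* (:1 :+ :1)) refl y z)) (1+bit≢0 bit))))
      where
      1+bit≢0 : ∀ {y} → Bit y → 1# + y ≢ 0#
      1+bit≢0 (inj₁ refl) = 1≢0 ∘ trans (sym (+-identityʳ 1#))
      1+bit≢0 (inj₂ refl) = 1+1≢0

      unwrap : ∀ {V ℓ} → (∃ λ y′ → ∃ λ z′ → ℓ ≡ (0# , y′ , z′) × Bit y′ × Near V y′ z′) →
               ∃ λ y′ → ∃ λ z′ → ℓ ≡ (0# , y′ , z′) × Bit y′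
      unwrap (y′ , z′ , eq , bit′ , _) = y′ , z′ , eq , bit′

    map-near : ∀ {V y z y′ z′} → Bit y → Bit y′ → ψ (0# , y , z) ≡ (0# , y′ , z′) → Near V y z → Near (φ V) y′ z′
    map-near {V@(a , b , c)} {y} {z} {y′} {z′} bit bit′ eq n with b + y ≟ 0#
    ... | yes b+y≡0 = on⇒near bit′ (map-∈-to eq (near⇒on bit n b+y≡0))
    ... | no  b+y≢0 =
      unwrap (pencil⇒special (subst (PointPencil (φ V)) eq (map-point-pencil (near⇒pencil bit n b+y≢0))))
      where
      unwrap : (∃ λ y₁ → ∃ λ z₁ → (0# , y′ , z′) ≡ (0# , y₁ , z₁) × Bit y₁ × Near (φ V) y₁ z₁) → Near (φ V) y′ z′
      unwrap (_ , _ , refl , _ , n′) = n′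

    -- The universal points of abscissas -1 and -2 would both map to universal points of [0, 0, z′],
    -- which all have abscissa -1, against injectivity.
    no-swap : ∀ {z z′} → ψ (0# , 1# , z) ≢ (0# , 0# , z′)
    no-swap {z} {z′} eq = 1≢0 (by
        (cong proj₁ (φ-injective {(- 1#) , - 1# , - z} {(- (1# + 1#)) , - 1# , - z}
          (same-abscissa (proj₁ u₁) (proj₁ u₂) (trans (universal-zero u₁) (sym (universal-zero u₂))))))
        (solve 0 (:1 :+ :- (:1 :+ :1) := :0 :+ (:- :1)) refl))
      where
      on : ∀ a → (a , - 1# , - z) ∈ (0# , 1# , z)
      on a = ∈-horizontal (-‿inverseˡ 1#) (-‿inverseˡ z)

      u₁ : PointUniversal (φ (- 1# , - 1# , - z)) (0# , 0# , z′)
      u₁ = subst (PointUniversal _) eq (map-point-universal (minus-one-universal-one (on (- 1#))))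

      u₂ : PointUniversal (φ (- (1# + 1#) , - 1# , - z)) (0# , 0# , z′)
      u₂ = subst (PointUniversal _) eq (map-point-universal (minus-two-universal-one (on (- (1# + 1#)))))

  translation : K → Iso E E
  translation t = shift _ 0# t (λ a b x → cong (λ b → x * W a b) (+-identityʳ b))

  -- The two values `0# * a` and `1# * a` of `W` agree, so the abscissa is zero; the other equations
  -- give `c` and then `b`.
  near-both : ∀ {V u v} → Near V 0# u → Near V 1# v → V ≡ (0# , v - u - 1# , - u)
  near-both {a , b , c} {u} {v} (near w₀ c₀) (near w₁ c₁) = cong₂ _,_
    (by (trans (sym w₁) w₀) (solve 1 (λ a → a :+ :0 :* a := :0 :+ :1 :* a) refl a))
    (cong₂ _,_
      (by (c₀ ⊹ (- 1#) · c₁)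
        (solve 4 (λ b c u v → b :+ (:0 :* (b :+ :1) :+ (:- :1) :* (:1 :* (b :+ :1))) :=
          v :- u :- :1 :+ ((c :+ u) :+ (:- :1) :* (c :+ v))) refl b c u v))
      (by c₀ (solve 3 (λ b c u → c :+ :0 :* (b :+ :1) := :- u :+ (c :+ u)) refl b c u)))

  abstract
    special-zero : ∀ (σ : Iso E E) z → ∃ λ z′ → Automorphism.ψ σ (0# , 0# , z) ≡ (0# , 0# , z′)
    special-zero σ z = from-bit (map-special (inj₁ refl) z)
      where
      open Automorphism σ
      module σ⁻¹ = Automorphism (inverse-iso σ)

      from-bit : (∃ λ y′ → ∃ λ z′ → ψ (0# , 0# , z) ≡ (0# , y′ , z′) × Bit y′) → ∃ λ z′ →
                 ψ (0# , 0# , z) ≡ (0# , 0# , z′)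
      from-bit (_ , z′ , eq , inj₁ refl) = z′ , eq
      -- Here the inverse would send a line with `y = 1` to one with `y = 0`.
      from-bit (_ , z′ , eq , inj₂ refl) = contradiction
        (inj₂-injective (trans (sym (σ⁻¹.ψ≡ _))
          (trans (cong (bwd σ) (sym (trans (ψ≡ _) (cong inj₂ eq)))) (bwd∘fwd σ _))))
        σ⁻¹.no-swap

    special-one : ∀ (σ : Iso E E) z → ∃ λ z′ → Automorphism.ψ σ (0# , 1# , z) ≡ (0# , 1# , z′)
    special-one σ z = from-bit (map-special (inj₂ refl) z)
      where
      open Automorphism σ

      from-bit : (∃ λ y′ → ∃ λ z′ → ψ (0# , 1# , z) ≡ (0# , y′ , z′) × Bit y′) → ∃ λ z′ →
                 ψ (0# , 1# , z) ≡ (0# , 1# , z′)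
      from-bit (_ , z′ , eq , inj₁ refl) = contradiction eq no-swap
      from-bit (_ , z′ , eq , inj₂ refl) = z′ , eq

  -- An automorphism fixing the line [0, 0, 0] is the identity

  module Normalised (σ : Iso E E) (fixes-origin : fwd σ (inj₂ (0# , 0# , 0#)) ≡ inj₂ (0# , 0# , 0#)) where
    open Automorphism σ

    α β : K → K
    α z = proj₁ (special-zero σ z)
    β z = proj₁ (special-one σ z)

    α≡ : ∀ z → ψ (0# , 0# , z) ≡ (0# , 0# , α z)
    α≡ z = proj₂ (special-zero σ z)

    β≡ : ∀ z → ψ (0# , 1# , z) ≡ (0# , 1# , β z)
    β≡ z = proj₂ (special-one σ z)

    axis-image : ∀ z z′ → φ (0# , z′ - z - 1# , - z) ≡ (0# , β z′ - α z - 1# , - α z)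
    axis-image z z′ = near-both
      (map-near (inj₁ refl) (inj₁ refl) (α≡ z) (near-axis (trans (-‿inverseˡ z) (sym (zeroˡ _)))))
      (map-near (inj₂ refl) (inj₂ refl) (β≡ z′) (near-axis
        (solve 2 (λ z z′ → :- z :+ z′ := :1 :* (z′ :- z :- :1 :+ :1)) refl z z′)))

    -- The axis point for `z` and `z + 1#` has `b = 0` and lies on [0, 0, z]; its image must lie on
    -- the image line. In `β≡α` the same is done with `b = -1` and [0, 1, z].
    β-suc : ∀ z → β (z + 1#) ≡ α z + 1#
    β-suc z = by (proj₁ (horizontal⇒ (subst (_∈ (0# , 0# , α z)) (axis-image z (z + 1#))
        (map-∈-to (α≡ z) (∈-horizontal (solve 1 (λ z → z :+ :1 :- z :- :1 :+ :0 := :0) refl z) (-‿inverseˡ z))))))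
      (solve 2 (λ b a → b :+ :0 := a :+ :1 :+ (b :- a :- :1 :+ :0)) refl (β (z + 1#)) (α z))

    β≡α : ∀ z → β z ≡ α z
    β≡α z = by (proj₁ (horizontal⇒ (subst (_∈ (0# , 1# , β z)) (axis-image z z)
        (map-∈-to (β≡ z) (∈-horizontal (solve 1 (λ z → z :- z :- :1 :+ :1 := :0) refl z) (-‿inverseˡ z))))))
      (solve 2 (λ b a → b :+ :0 := a :+ (b :- a :- :1 :+ :1)) refl (β z) (α z))

    α-id : ∀ z → α z ≡ z
    α-id = translation-unique α
      (cong (proj₂ ∘ proj₂) (trans (sym (α≡ 0#)) (inj₂-injective (trans (sym (ψ≡ _)) fixes-origin))))
      (λ z → trans (sym (β≡α (z + 1#))) (β-suc z))

    fix-zero : ∀ z → ψ (0# , 0# , z) ≡ (0# , 0# , z)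
    fix-zero z = trans (α≡ z) (cong (λ z → 0# , 0# , z) (α-id z))

    fix-one : ∀ z → ψ (0# , 1# , z) ≡ (0# , 1# , z)
    fix-one z = trans (β≡ z) (cong (λ z → 0# , 1# , z) (trans (β≡α z) (α-id z)))

    fix-axis : ∀ b c → φ (0# , b , c) ≡ (0# , b , c)
    fix-axis b c = subst (λ V → φ V ≡ V)
      (cong₂ (λ b c → 0# , b , c)
        (solve 2 (λ b c → b :- c :+ :1 :- (:- c) :- :1 := b) refl b c) (solve 1 (λ c → :- (:- c) := c) refl c))
      (trans (axis-image (- c) (b - c + 1#))
        (cong₂ (λ u v → 0# , v - u - 1# , - u) (α-id _) (trans (β≡α _) (α-id _))))

    fix-line : ∀ {P Q ℓ} → φ P ≡ P → φ Q ≡ Q → P ∈ ℓ → Q ∈ ℓ → P ≢ Q → ψ ℓ ≡ ℓ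
    fix-line {P} {Q} {ℓ} φP φQ Pℓ Qℓ =
      line-unique (subst (_∈ ψ ℓ) φP (map-∈ Pℓ)) (subst (_∈ ψ ℓ) φQ (map-∈ Qℓ)) Pℓ Qℓ

    fix-point : ∀ {P ℓ m} → ψ ℓ ≡ ℓ → ψ m ≡ m → P ∈ ℓ → P ∈ m → ℓ ≢ m → φ P ≡ P
    fix-point ψℓ ψm Pℓ Pm = point-unique (map-∈-to ψℓ Pℓ) (map-∈-to ψm Pm) Pℓ Pm

    -- Every line has a fixed point on the axis, so one more fixed point off the axis is enough.
    fix-line-via : ∀ {a b c x y z} → φ (a , b , c) ≡ (a , b , c) → (a , b , c) ∈ (x , y , z) → a ≢ 0# →
                   ψ (x , y , z) ≡ (x , y , z)
    fix-line-via {x = x} {y} {z} φP Pℓ a≢0 = fix-line φP (fix-axis (- y) (- z)) Pℓ (∈-axis x y z) (a≢0 ∘ cong proj₁)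

    -1≢0 : - 1# ≢ 0#
    -1≢0 eq = 1≢0 (by ((- 1#) · eq) (solve 0 (:1 :+ (:- :1) :* :0 := :0 :+ (:- :1) :* (:- :1)) refl))

    fix-universal-point : ∀ z → φ (- 1# , 0# , - z) ≡ (- 1# , 0# , - z)
    fix-universal-point z = same-abscissa (proj₁ u) on (universal-zero u)
      where
      on : (- 1# , 0# , - z) ∈ (0# , 0# , z)
      on = ∈-zero-ordinate (sym (zeroˡ _))

      u : PointUniversal (φ (- 1# , 0# , - z)) (0# , 0# , z)
      u = subst (PointUniversal _) (fix-zero z) (map-point-universal (minus-one-universal-zero on))

    fix-opposite : ∀ y z → ψ (- y , y , z) ≡ (- y , y , z)
    fix-opposite y z = fix-line-via (fix-universal-point z) (∈-zero-ordinate
      (solve 1 (λ y → y := (:- y) :* (:- :1)) refl y)) -1≢0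

    -- Since `W a (- 1#)` is `a`, both incidence equations have the right side `x * a`.
    ∈-minus-one-ordinate : ∀ {a c x y z} → - 1# + y ≡ x * a → c + z ≡ x * a → (a , - 1# , c) ∈ (x , y , z)
    ∈-minus-one-ordinate {a} {x = x} e f = inc e (trans f (cong (x *_) (solve 1 (λ a → a := :W a (:- :1)) refl a)))

    on-one : ∀ a c → (a , - 1# , c) ∈ (0# , 1# , - c)
    on-one a c = ∈-horizontal (-‿inverseˡ 1#) (-‿inverseʳ c)

    -- The point is the meet of [0, 1, -c] with a line fixed by `fix-opposite`; that line's `y` must
    -- satisfy `y * (a + 1#) = 1#`.
    fix-on-one-generic : ∀ {a} c → a ≢ - 1# → φ (a , - 1# , c) ≡ (a , - 1# , c)
    fix-on-one-generic {a} c a≢-1 = fix-point (fix-opposite y (y - 1# - c)) (fix-one (- c))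
      (∈-minus-one-ordinate
        (by y≡ (solve 2 (λ a y → :- :1 :+ y :+ :1 := (:- y) :* a :+ y :* (a :+ :1)) refl a y))
        (by y≡ (solve 3 (λ a y c → c :+ (y :- :1 :- c) :+ :1 := (:- y) :* a :+ y :* (a :+ :1)) refl a y c)))
      (on-one a c)
      (λ eq → 1≢0 (by ((- 1#) · y≡ ⊹ (- (a + 1#)) · cong proj₁ eq)
        (solve 2 (λ a y → :1 :+ ((:- :1) :* :1 :+ (:- (a :+ :1)) :* :0) :=
          :0 :+ ((:- :1) :* (y :* (a :+ :1)) :+ (:- (a :+ :1)) :* (:- y))) refl a y)))
      where
      quot : Σ K λ q → q * (a + 1#) ≡ 1#
      quot = divide (a + 1#) (a≢-1 ∘ +≡0⇒≡-) 1#

      y : K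
      y = proj₁ quot

      y≡ : y * (a + 1#) ≡ 1#
      y≡ = proj₂ quot

    fix-on-one : ∀ a c → φ (a , - 1# , c) ≡ (a , - 1# , c)
    fix-on-one a c with a ≟ - 1#
    ... | no  a≢-1 = fix-on-one-generic c a≢-1
    ... | yes refl = by-image (φ P) refl
      where
      P : Coords
      P = - 1# , - 1# , c

      φP-on : φ P ∈ (0# , 1# , - c)
      φP-on = map-∈-to (fix-one (- c)) (on-one (- 1#) c)

      by-image : ∀ Q → φ P ≡ Q → Q ≡ P
      by-image (a′ , b′ , c′) eq with a′ ≟ - 1#
      ... | yes a′≡-1 = same-abscissa (subst (_∈ _) eq φP-on) (on-one (- 1#) c) a′≡-1
      -- Every other point of the line is its own image, so injectivity leaves no other image for
      -- the last point.
      ... | no  a′≢-1 = φ-injective (trans (subst (λ R → φ R ≡ R) R≡Q (fix-on-one-generic c a′≢-1)) (sym eq))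
        where
        R≡Q : (a′ , - 1# , c) ≡ (a′ , b′ , c′)
        R≡Q = same-abscissa (on-one a′ c) (subst (_∈ _) eq φP-on) refl

    -- The line meets `b = -1` at the abscissa `(y - 1) / x`, which is nonzero because `y ≢ 1#`.
    fix-sloped : ∀ {x y} z → x ≢ 0# → y ≢ 1# → ψ (x , y , z) ≡ (x , y , z)
    fix-sloped {x} {y} z x≢0 y≢1 = fix-line-via (fix-on-one a (y - 1# - z))
      (∈-minus-one-ordinate
        (by (sym a≡) (solve 3 (λ a x y → :- :1 :+ y :+ a :* x := x :* a :+ (y :- :1)) refl a x y))
        (by (sym a≡) (solve 4 (λ a x y z → y :- :1 :- z :+ z :+ a :* x := x :* a :+ (y :- :1)) refl a x y z)))
      (λ a≡0 → y≢1 (by (sym a≡ ⊹ x · a≡0)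
        (solve 3 (λ a x y → y :+ (a :* x :+ x :* :0) := :1 :+ (y :- :1 :+ x :* a)) refl a x y)))
      where
      a : K
      a = proj₁ (divide x x≢0 (y - 1#))

      a≡ : a * x ≡ y - 1#
      a≡ = proj₂ (divide x x≢0 (y - 1#))

    -- For `x = 0` the argument is dual to that of `fix-on-one`: all other lines through the fixed
    -- axis point are fixed.
    fix-y≢1 : ∀ x {y} z → y ≢ 1# → ψ (x , y , z) ≡ (x , y , z)
    fix-y≢1 x {y} z y≢1 with x ≟ 0#
    ... | no  x≢0  = fix-sloped z x≢0 y≢1
    ... | yes refl = by-image (ψ (0# , y , z)) refl
      where
      by-image : ∀ ℓ → ψ (0# , y , z) ≡ ℓ → ℓ ≡ (0# , y , z)
      by-image (x′ , y′ , z′) eq with x′ ≟ 0#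
      ... | yes refl =
        same-slope (subst₂ _∈_ (fix-axis (- y) (- z)) eq (map-∈ (∈-axis 0# y z))) (∈-axis 0# y z) refl
      ... | no x′≢0  = ψ-injective (trans (subst (λ m → ψ m ≡ m) m≡ (fix-sloped z x′≢0 y≢1)) (sym eq))
        where
        m≡ : (x′ , y , z) ≡ (x′ , y′ , z′)
        m≡ = same-slope (∈-axis x′ y z) (subst₂ _∈_ (fix-axis (- y) (- z)) eq (map-∈ (∈-axis 0# y z))) refl

    -- The second line is [x, -1, z] with `x * a = -1`, covered by `fix-y≢1` since -1 and 1 differ.
    fix-zero-ordinate : ∀ {a} z → a ≢ 0# → φ (a , 0# , - z) ≡ (a , 0# , - z)
    fix-zero-ordinate {a} z a≢0 = fix-point (fix-zero z)
      (fix-y≢1 x z λ eq → 1+1≢0 (by (sym eq) (solve 0 (:1 :+ :1 :+ (:- :1) := :0 :+ :1) refl)))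
      (∈-zero-ordinate (sym (zeroˡ a))) (∈-zero-ordinate (sym (proj₂ (divide a a≢0 (- 1#)))))
      (-1≢0 ∘ sym ∘ cong (proj₁ ∘ proj₂))
      where
      x : K
      x = proj₁ (divide a a≢0 (- 1#))

    fix-lines : ∀ ℓ → ψ ℓ ≡ ℓ
    fix-lines (x , y , z) with y ≟ 1# | x ≟ 0#
    ... | no  y≢1  | _        = fix-y≢1 x z y≢1
    ... | yes refl | yes refl = fix-one z
    -- The remaining lines meet `b = 0` at the abscissa `1 / x`, a point just shown to be fixed.
    ... | yes refl | no x≢0   = fix-line-via (fix-zero-ordinate z a≢0)
      (∈-zero-ordinate (by (sym a≡) (solve 2 (λ a x → :1 :+ a :* x := x :* a :+ :1) refl a x))) a≢0
      where
      a : K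
      a = proj₁ (divide x x≢0 1#)

      a≡ : a * x ≡ 1#
      a≡ = proj₂ (divide x x≢0 1#)

      a≢0 : a ≢ 0#
      a≢0 a≡0 = 1≢0 (by (sym a≡ ⊹ x · a≡0)
        (solve 2 (λ a x → :1 :+ (a :* x :+ x :* :0) := :0 :+ (:1 :+ x :* a)) refl a x))

    fix-points : ∀ P → φ P ≡ P
    fix-points P@(a , b , c) =
      -- Each point is the meet of its lines of slopes 0 and 1.
      fix-point {P} {0# , - b , - c} {1# , 1# * a - b , 1# * W a b - c} (fix-lines _) (fix-lines _)
      (horizontal-through a b c)
      (inc (solve 2 (λ a b → b :+ (:1 :* a :- b) :=
        :1 :* a) refl a b) (solve 2 (λ a b → b :+ (:1 :* a :- b) := :1 :* a) refl (W a b) c))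
      (1≢0 ∘ sym ∘ cong proj₁)

    identity : ∀ v → fwd σ v ≡ v
    identity (inj₁ P) = trans (φ≡ P) (cong inj₁ (fix-points P))
    identity (inj₂ ℓ) = trans (ψ≡ ℓ) (cong inj₂ (fix-lines ℓ))

  automorphism-translation : ∀ (σ : Iso E E) → ∃ λ t → ∀ v → fwd (translation t) v ≡ fwd σ v
  automorphism-translation σ = t , λ v →
    trans (cong (fwd (translation t)) (sym (Normalised.identity ρ fixes v))) (fwd∘bwd (translation t) (fwd σ v))
    where
    open Automorphism σ
    s t : K
    s = proj₁ (special-zero σ 0#)
    -- A translation subtracts `t` from the last coordinate of a line, so this one takes [0, 0, 0]
    -- to [0, 0, s], as `σ` does.
    t = - s

    ρ : Iso E E
    ρ = compose-iso σ (inverse-iso (translation t))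

    fixes : fwd ρ (inj₂ (0# , 0# , 0#)) ≡ inj₂ (0# , 0# , 0#)
    fixes = trans (cong (bwd (translation t)) (trans (ψ≡ _) (cong inj₂ (proj₂ (special-zero σ 0#)))))
      (cong₂ (λ y z → inj₂ (0# , y , z))
        (solve 0 (:0 :+ :- (:- :0) := :0) refl) (solve 1 (λ s → s :+ :- (:- (:- s)) := :0) refl s))

-- Transfer to residues modulo p, and counting automorphisms

module _ {V : Set} {E₁ E₁′ E₂ E₂′ : V → V → Set} where
  replace-edges : (∀ u v → E₁′ u v → E₁ u v) → (∀ u v → E₁ u v → E₁′ u v) →
                  (∀ u v → E₂ u v → E₂′ u v) → (∀ u v → E₂′ u v → E₂ u v) → Iso E₁ E₂ → Iso E₁′ E₂′
  replace-edges from₁ to₁ to₂ from₂ σ = record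
    { fwd = fwd σ ; bwd = bwd σ ; bwd∘fwd = bwd∘fwd σ ; fwd∘bwd = fwd∘bwd σ
    ; pres  = λ u v e → to₂ _ _ (pres σ u v (from₁ u v e))
    ; refl' = λ u v e → to₁ u v (refl' σ u v (from₂ _ _ e)) }

module Concrete (p : ℕ) .{{_ : NonZero p}} (p-prime : Prime p) (5<p : 5 < p) where
  module M = Modular p

  primeField : PrimeField
  primeField = record
    { Carrier            = F p
    ; isCommutativeRing  = M.isCommutativeRing
    ; _≟_                = Finₚ._≟_
    ; inverse            = M.*-inverse p-prime
    ; 1+1≢0              = 1+1≢0
    ; five-avoiding      = avoiding 5<p
    ; translation-unique = M.translation-unique }
    where
    1+1≢0 : add p M.1ₚ M.1ₚ ≢ M.0ₚ
    1+1≢0 eq with () ← M.fromℕ-injective (ℕₚ.≤-trans (ℕₚ.m≤m+n 3 3) 5<p) (ℕₚ.≤-trans (ℕₚ.m≤m+n 1 5) 5<p)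
                         (trans (sym (M.fromℕ-+ 1 1)) eq)

  open Geometry primeField

  module _ {g g′ : F p → F p → F p → F p} (g≡ : ∀ a b x → g a b x ≡ g′ a b x) where
    to-edge : ∀ u v → Adj p (fR p) g u v → Edge g′ u v
    to-edge (inj₁ (a , b , _)) (inj₂ (x , _)) (e , f) =
      point-line (inc (trans e (M.*-comm a x)) (trans f (g≡ a b x)))
    to-edge (inj₂ (x , _)) (inj₁ (a , b , _)) (e , f) =
      line-point (inc (trans e (M.*-comm a x)) (trans f (g≡ a b x)))

    from-edge : ∀ u v → Edge g′ u v → Adj p (fR p) g u v
    from-edge (inj₁ (a , b , _)) (inj₂ (x , _)) (point-line (inc e f)) =
      trans e (M.*-comm x a) , trans f (sym (g≡ a b x))
    from-edge (inj₂ (x , _)) (inj₁ (a , b , _)) (line-point (inc e f)) =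
      trans e (M.*-comm x a) , trans f (sym (g≡ a b x))

  origin : Coords ⊎ Coords
  origin = inj₁ (M.0ₚ , M.0ₚ , M.0ₚ)

  toE : ∀ u v → R p u v → E u v
  toE = to-edge W-form

  fromE : ∀ u v → E u v → R p u v
  fromE = from-edge W-form

  translation-injective : ∀ t t′ → (∀ v → fwd (translation t) v ≡ fwd (translation t′) v) → t ≡ t′
  translation-injective t t′ eq = trans (sym (M.+-identityˡ t)) (trans (cong (proj₂ ∘ proj₂)
    (inj₁-injective (eq origin))) (M.+-identityˡ t′))

  automorphisms : AutCard (R p) p
  automorphisms =
    (λ t → replace-edges toE fromE fromE toE (translation t)) ,
    (λ σ → automorphism-translation (replace-edges fromE toE toE fromE σ)) ,
    translation-injective

  module _ (h : F p → F p → F p) where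
    Eₕ : Coords ⊎ Coords → Coords ⊎ Coords → Set
    Eₕ = Edge (λ a b x → h a x)

    -- One automorphism too many: all p shifts of the second coordinate and a single nontrivial
    -- shift of the third.
    shifts : Fin (suc p) → Iso Eₕ Eₕ
    shifts zero    = shift _ M.0ₚ M.1ₚ λ _ _ _ → refl
    shifts (suc t) = shift _ t M.0ₚ λ _ _ _ → refl

    cancel-0 : ∀ {s t} → add p M.0ₚ s ≡ add p M.0ₚ t → s ≡ t
    cancel-0 {s} {t} e = trans (sym (M.+-identityˡ s)) (trans e (M.+-identityˡ t))

    shifts-injective : ∀ i j → (∀ v → fwd (shifts i) v ≡ fwd (shifts j) v) → i ≡ j
    shifts-injective zero    zero     _  = refl
    shifts-injective zero    (suc t)  eq =
      contradiction (cancel-0 (cong (proj₂ ∘ proj₂) (inj₁-injective (eq origin)))) 1≢0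
    shifts-injective (suc t) zero     eq =
      contradiction (cancel-0 (sym (cong (proj₂ ∘ proj₂) (inj₁-injective (eq origin))))) 1≢0
    shifts-injective (suc t) (suc t′) eq = cong suc (cancel-0 (cong (proj₁ ∘ proj₂) (inj₁-injective (eq origin))))

  -- Conjugating the `suc p` shifts by an isomorphism gives distinct automorphisms of R, each one of
  -- p translations; the pigeonhole principle forbids this.
  no-isomorphism : ¬ Σ (F p → F p → F p) λ h → Iso (R p) (Adj p (fR p) (λ p1 p2 l1 → h p1 l1))
  no-isomorphism (h , iso) = Finₚ.<⇒notInjective (ℕₚ.n<1+n p) (λ {i} {j} → index-injective i j)
    where
    θ : Iso E (Eₕ h)
    θ = replace-edges fromE toE (to-edge λ _ _ _ → refl) (from-edge λ _ _ _ → refl) iso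

    conjugate : Fin (suc p) → Iso E E
    conjugate i = compose-iso θ (compose-iso (shifts h i) (inverse-iso θ))

    index : Fin (suc p) → F p
    index i = proj₁ (automorphism-translation (conjugate i))

    index-injective : ∀ i j → index i ≡ index j → i ≡ j
    -- Evaluating at `bwd θ v` cancels the inner `θ`; injectivity of `bwd θ` removes the outer one.
    index-injective i j eq = shifts-injective h i j λ v → fwd-injective (inverse-iso θ)
      (subst (λ u → bwd θ (fwd (shifts h i) u) ≡ bwd θ (fwd (shifts h j) u)) (fwd∘bwd θ v) (same (bwd θ v)))
      where
      same : ∀ w → fwd (conjugate i) w ≡ fwd (conjugate j) w
      same w = trans (sym (proj₂ (automorphism-translation (conjugate i)) w))
        (trans (cong (λ t → fwd (translation t) w) eq) (proj₂ (automorphism-translation (conjugate j)) w))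

theorem2p1 : (p : ℕ) .{{_ : NonZero p}} → Prime p → p % 3 ≡ 1 →
    AutCard (R p) p
    × ¬ (Σ (F p → F p → F p) λ h →
    Iso (R p) (Adj p (fR p) (λ p1 p2 l1 → h p1 l1)))
theorem2p1 p p-prime p%3≡1 = automorphisms , no-isomorphism
  where open Concrete p p-prime (5<p p-prime p%3≡1)
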